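{- Let $k\ge 3$ be an integer and let $G$ be a finite graph of treewidth $k$ and maximum degree $\Delta(G) \geq 3k-3$. Then the total chromatic number satisfies $\chi''(G) = \Delta(G)+1$.
   Context: Treewidth: a tree decomposition of $G$ is a tree $T$ with bags $V_t\subseteq V(G)$ ($t\in V(T)$) covering all vertices, such that each edge has both endpoints in some bag and for each vertex $v$ the set $\{t: v\in V_t\}$ induces a connected subtree of $T$; its width is the maximum bag size minus one; the treewidth of $G$ is the minimum width over all tree decompositions. The total chromatic number $\chi''(G)$ is the smallest integer $m$ such that there is an assignment of colours from a set of $m$ colours to all vertices and all edges of $G$ such that adjacent vertices receive different colours, edges sharing an endvertex receive different colours, and no edge receives the same colour as either of its endvertices. -}

module Defs where

open import Data.Nat using (ℕ; zero; suc; _+_; _∸_; _≤_; _<_; _⊔_)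
open import Data.Fin using (Fin; zero; suc; inject₁; fromℕ)
open import Data.Bool using (Bool; true; false; if_then_else_)
open import Data.List using (foldr; map; allFin)
open import Data.Product using (Σ; ∃; ∃-syntax; _×_; _,_)
open import Relation.Binary.PropositionalEquality using (_≡_; _≢_)
open import Relation.Nullary using (¬_)
open import Function.Definitions using (Injective)

record Graph : Set where
  field
    n      : ℕ
    adj    : Fin n → Fin n → Bool
    sym    : ∀ u v → adj u v ≡ adj v u
    irrefl : ∀ v → adj v v ≡ false
open Graph public

count : ∀ {m} → (Fin m → Bool) → ℕ
count {zero}  p = 0
count {suc m} p = (if p zero then 1 else 0) + count (λ i → p (suc i))

maxFin : ∀ {m} → (Fin m → ℕ) → ℕ
maxFin {m} f = foldr _⊔_ 0 (map f (allFin m))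

degree : (G : Graph) → Fin (n G) → ℕ
degree G v = count (adj G v)

Δ : Graph → ℕ
Δ G = maxFin (degree G)

data ConnIn (G : Graph) (P : Fin (n G) → Bool) : Fin (n G) → Fin (n G) → Set where
  here : ∀ {s} → P s ≡ true → ConnIn G P s s
  step : ∀ {s u t} → P s ≡ true → adj G s u ≡ true → ConnIn G P u t → ConnIn G P s t

Connected : Graph → Set
Connected G = ∀ s t → ConnIn G (λ _ → true) s t

HasCycle : Graph → Set
HasCycle G =
  ∃[ j ] Σ (Fin (suc (suc (suc j))) → Fin (n G)) λ f →
    Injective _≡_ _≡_ f
    × (∀ (i : Fin (suc (suc j))) → adj G (f (inject₁ i)) (f (suc i)) ≡ true)
    × adj G (f (fromℕ (suc (suc j)))) (f zero) ≡ true

IsTree : Graph → Set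
IsTree T = (0 < n T) × Connected T × ¬ HasCycle T

record TreeDecomposition (G : Graph) : Set where
  field
    T      : Graph
    isTree : IsTree T
    bag    : Fin (n T) → Fin (n G) → Bool
    cover  : ∀ v → ∃[ t ] bag t v ≡ true
    edge   : ∀ u v → adj G u v ≡ true → ∃[ t ] (bag t u ≡ true × bag t v ≡ true)
    subtree : ∀ v s t → bag s v ≡ true → bag t v ≡ true →
              ConnIn T (λ r → bag r v) s t

width : ∀ {G} → TreeDecomposition G → ℕ
width D = maxFin (λ t → count (TreeDecomposition.bag D t)) ∸ 1

Treewidth≡ : Graph → ℕ → Set
Treewidth≡ G k =
  (∃[ D ] width {G} D ≡ k) × (∀ (D : TreeDecomposition G) → k ≤ width D)

record TotalColouring (G : Graph) (m : ℕ) : Set where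
  field
    vcol : Fin (n G) → Fin m
    ecol : Fin (n G) → Fin (n G) → Fin m
    ecol-sym : ∀ u v → adj G u v ≡ true → ecol u v ≡ ecol v u
    vv : ∀ u v → adj G u v ≡ true → vcol u ≢ vcol v
    ee : ∀ u v w → adj G u v ≡ true → adj G u w ≡ true → v ≢ w →
         ecol u v ≢ ecol u w
    ve : ∀ u v → adj G u v ≡ true → ecol u v ≢ vcol u

TotalChromatic≡ : Graph → ℕ → Set
TotalChromatic≡ G m = TotalColouring G m × (∀ m' → m' < m → ¬ TotalColouring G m')

module Submission where

open import Defs
open import Data.Nat using (ℕ; zero; suc; _+_; _*_; _∸_; _⊔_; _≤_; _<_; _≤?_; _<?_; z≤n; s≤s; s≤s⁻¹)
open import Data.Nat.Induction using (<-wellFounded)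
open import Data.Nat.Properties hiding (_≟_)
open import Data.Bool using (Bool; true; false; not; _∧_; _∨_; if_then_else_)
import Data.Bool.Properties as Bool
open import Data.Fin using (Fin; zero; suc; toℕ; fromℕ; fromℕ<; inject₁; _≟_)
import Data.Fin.Properties as Fin
open import Data.Maybe using (Maybe; just; nothing)
import Data.Maybe.Properties as Maybe
open import Data.List using (List; []; _∷_; _++_; length; map; filter; tabulate; allFin; lookup; foldr; cartesianProduct)
open import Data.List.Extrema ≤-totalOrder
  using (argmin; argmax; argmin-all; argmax-all; f[argmin]≤f[xs]; f[xs]≤f[argmax])
open import Data.List.Membership.Propositional using (_∈_; _∉_)
open import Data.List.Membership.Propositional.Properties
open import Data.List.Properties using (length-++; length-map; length-tabulate)
open import Data.List.Relation.Unary.All using (All; []; _∷_)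
import Data.List.Relation.Unary.All as All
import Data.List.Relation.Unary.All.Properties as All
open import Data.List.Relation.Unary.AllPairs using ([]; _∷_)
open import Data.List.Relation.Unary.Any using (here; there)
open import Data.List.Relation.Unary.Unique.Propositional using (Unique)
open import Data.List.Relation.Unary.Unique.Propositional.Properties using (allFin⁺)
import Data.List.Relation.Unary.Unique.Propositional.Properties as Unique
open import Data.Product using (∃; ∃-syntax; _×_; _,_; proj₁; proj₂)
open import Data.Sum using (_⊎_; inj₁; inj₂)
open import Data.Empty using (⊥; ⊥-elim)
open import Function using (_∘_; id)
open import Induction.WellFounded using (Acc; acc)
open import Relation.Binary.Definitions using (Tri; tri<; tri≈; tri>)
open import Relation.Binary.PropositionalEquality hiding ([_]) renaming (sym to ≡-sym)
open import Relation.Nullary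
open import Relation.Nullary.Decidable using (decidable-stable)

-- Let D = Δ(G). A tree decomposition orders the vertices so that every vertex v has a set top(v) of at most
-- k + 1 vertices which contains v and all of its later neighbours, and whose elements w later than another element u
-- lie in top(u). Let v be the earliest vertex with an earlier neighbour, W the rest of top(v) (|W| ≤ k) and U the set of
-- earlier neighbours of v. By the choice of v every u in U has degree at most k and N(u) ⊆ {v} ∪ W.
-- Remove an edge vx with x in U, colour the rest by induction, and forget the colours of the vertices in U: as
-- 2k ≤ D, they can be coloured at the very end. It remains to colour vx. Let b be a colour missing at v.
-- Call w "free for x" if the colour of vw is missing at x. If y in U is free for x, the colour of vy may move to vx,
-- so we are done if b is missing at x or at such a y; otherwise b occurs on an edge from each of them to its own
-- vertex w_y of W. Since D ≥ 3k - 3, counting the colours at x shows that all but at most one vertex of W are free for x,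
-- that some y in U is free for x, and that there are two such y if some vertex of W is not free for x; the
-- first of these also holds for y once the uncoloured edge has moved to vy.
-- Exchanging the colours of vw and xw, where xw has colour b, makes the old colour of vw missing at v; this
-- lets us finish via y as soon as w is free for both x and y (or with the roles of x and y exchanged). If this never
-- applies, then w_x is not free for x, its colour α at v occurs on an edge xw', and exchanging at both w_x and w'
-- works with a suitable y.

-- Counting with duplicate-free lists

false≢true : ∀ {b} → b ≡ false → b ≡ true → ⊥
false≢true refl ()

-- Pigeonhole by induction: the partner of the head is cut out of `ys`, and `inj` ensures that no
-- later element had the same partner. With a relation in place of a function, partners can come
-- from existential witnesses.
length-≤-injection : ∀ {A B : Set} (R : A → B → Set) →
  (∀ {a a' b} → R a b → R a' b → a ≡ a') →
  ∀ {xs : List A} {ys : List B} → Unique xs →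
  (∀ {a} → a ∈ xs → ∃[ b ] b ∈ ys × R a b) → length xs ≤ length ys
length-≤-injection R inj [] f = z≤n
length-≤-injection R inj {x ∷ xs} (x∉ ∷ u) f with f (here refl)
... | b , b∈ , xRb with ys₁ , ys₂ , refl ← ∈-∃++ b∈ =
  subst (suc (length xs) ≤_) (≡-sym (trans (length-++ ys₁) (trans (+-suc _ _) (cong suc (≡-sym (length-++ ys₁))))))
    (s≤s (length-≤-injection R inj u f'))
  where
  f' : ∀ {a} → a ∈ xs → ∃[ c ] c ∈ ys₁ ++ ys₂ × R a c
  f' a∈ with f (there a∈)
  ... | c , c∈ , aRc with ∈-++⁻ ys₁ c∈
  ... | inj₁ c∈₁ = c , ∈-++⁺ˡ c∈₁ , aRc
  ... | inj₂ (there c∈₂) = c , ∈-++⁺ʳ ys₁ c∈₂ , aRc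
  ... | inj₂ (here refl) = ⊥-elim (All.lookup x∉ a∈ (inj xRb aRc))

length-≤-⊆ : ∀ {A : Set} {xs ys : List A} → Unique xs → (∀ {a} → a ∈ xs → a ∈ ys) → length xs ≤ length ys
length-≤-⊆ u f = length-≤-injection _≡_ (λ { refl refl → refl }) u (λ a∈ → _ , f a∈ , refl)

elems : ∀ {m} → (Fin m → Bool) → List (Fin m)
elems p = filter (λ i → p i Bool.≟ true) (allFin _)

∈-elems⁺ : ∀ {m} {p : Fin m → Bool} {i} → p i ≡ true → i ∈ elems p
∈-elems⁺ {p = p} {i} e = ∈-filter⁺ (λ i → p i Bool.≟ true) (∈-allFin i) e

∈-elems⁻ : ∀ {m} {p : Fin m → Bool} {i} → i ∈ elems p → p i ≡ true
∈-elems⁻ {m} {p} i∈ = proj₂ (∈-filter⁻ (λ i → p i Bool.≟ true) {xs = allFin m} i∈)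

elems-unique : ∀ {m} (p : Fin m → Bool) → Unique (elems p)
elems-unique p = Unique.filter⁺ (λ i → p i Bool.≟ true) (allFin⁺ _)

length-filter-tabulate : ∀ {m l} (p : Fin l → Bool) (f : Fin m → Fin l) →
  length (filter (λ i → p i Bool.≟ true) (tabulate f)) ≡ count (p ∘ f)
length-filter-tabulate {zero} p f = refl
length-filter-tabulate {suc m} p f with p (f zero)
... | true = cong suc (length-filter-tabulate p (f ∘ suc))
... | false = length-filter-tabulate p (f ∘ suc)

length-elems : ∀ {m} (p : Fin m → Bool) → length (elems p) ≡ count p
length-elems p = length-filter-tabulate p id

count-mono : ∀ {m} {p q : Fin m → Bool} → (∀ i → p i ≡ true → q i ≡ true) → count p ≤ count q
count-mono {p = p} {q} h = subst₂ _≤_ (length-elems p) (length-elems q)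
  (length-≤-⊆ (elems-unique p) (λ i∈ → ∈-elems⁺ {p = q} (h _ (∈-elems⁻ {p = p} i∈))))

count-mono-< : ∀ {m} {p q : Fin m → Bool} → (∀ i → p i ≡ true → q i ≡ true) →
  ∀ {j} → p j ≡ false → q j ≡ true → count p < count q
count-mono-< {p = p} {q} h {j} pj qj = subst₂ _≤_ (cong suc (length-elems p)) (length-elems q)
  (length-≤-⊆ (All.tabulate (λ i∈ e → j∉ (subst (_∈ elems p) (≡-sym e) i∈)) ∷ elems-unique p) λ
    { (here refl) → ∈-elems⁺ {p = q} qj
    ; (there i∈) → ∈-elems⁺ {p = q} (h _ (∈-elems⁻ {p = p} i∈)) })
  where
  j∉ : j ∉ elems p
  j∉ j∈ = false≢true pj (∈-elems⁻ {p = p} j∈)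

≤-maxFin : ∀ {m} (f : Fin m → ℕ) i → f i ≤ maxFin f
≤-maxFin {m} f i = go (allFin m) (∈-allFin i)
  where
  go : ∀ xs → i ∈ xs → f i ≤ foldr _⊔_ 0 (map f xs)
  go (x ∷ xs) (here refl) = m≤m⊔n _ _
  go (x ∷ xs) (there i∈) = ≤-trans (go xs i∈) (m≤n⊔m (f x) _)

maxFin-attained : ∀ {m} (f : Fin m → ℕ) → maxFin f ≡ 0 ⊎ ∃[ i ] f i ≡ maxFin f
maxFin-attained {m} f = go (allFin m)
  where
  go : ∀ xs → foldr _⊔_ 0 (map f xs) ≡ 0 ⊎ ∃[ i ] f i ≡ foldr _⊔_ 0 (map f xs)
  go [] = inj₁ refl
  go (x ∷ xs) with ≤-total (foldr _⊔_ 0 (map f xs)) (f x) | go xs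
  ... | inj₁ le | _ = inj₂ (x , ≡-sym (m≥n⇒m⊔n≡m le))
  ... | inj₂ le | inj₁ e = inj₁ (trans (m≤n⇒m⊔n≡n le) e)
  ... | inj₂ le | inj₂ (i , e) = inj₂ (i , trans e (≡-sym (m≤n⇒m⊔n≡n le)))

exists-argmin : ∀ {m} {P : Fin m → Set} → (∀ i → Dec (P i)) → (f : Fin m → ℕ) → ∃ P →
  ∃[ j ] P j × (∀ i → P i → f j ≤ f i)
exists-argmin {m} {P} P? f (j , pj) = argmin f j xs , argmin-all f pj (All.all-filter P? (allFin m)) ,
  λ i pi → All.lookup (f[argmin]≤f[xs] {f = f} j xs) (∈-filter⁺ P? (∈-allFin i) pi)
  where xs = filter P? (allFin m)

exists-argmax : ∀ {m} {P : Fin m → Set} → (∀ i → Dec (P i)) → (f : Fin m → ℕ) → ∃ P →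
  ∃[ j ] P j × (∀ i → P i → f i ≤ f j)
exists-argmax {m} {P} P? f (j , pj) = argmax f j xs , argmax-all f pj (All.all-filter P? (allFin m)) ,
  λ i pi → All.lookup (f[xs]≤f[argmax] {f = f} j xs) (∈-filter⁺ P? (∈-allFin i) pi)
  where xs = filter P? (allFin m)

-- Trees

ConnIn-mono : ∀ {G P Q s t} → (∀ i → P i ≡ true → Q i ≡ true) → ConnIn G P s t → ConnIn G Q s t
ConnIn-mono h (here p) = here (h _ p)
ConnIn-mono h (step p a c) = step (h _ p) a (ConnIn-mono h c)

ConnIn-end : ∀ {G P s t} → ConnIn G P s t → P t ≡ true
ConnIn-end (here p) = p
ConnIn-end (step _ _ c) = ConnIn-end c

ConnIn-snoc : ∀ {G P s t u} → ConnIn G P s t → adj G t u ≡ true → P u ≡ true → ConnIn G P s u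
ConnIn-snoc (here p) a q = step p a (here q)
ConnIn-snoc (step p a' c) a q = step p a' (ConnIn-snoc c a q)

-- The last index lists the visited vertices, so that `lookup` turns a path into the injective map
-- required by `HasCycle`.
data SimplePath (G : Graph) (P : Fin (n G) → Bool) : Fin (n G) → Fin (n G) → List (Fin (n G)) → Set where
  stop : ∀ {t} → P t ≡ true → SimplePath G P t t (t ∷ [])
  cons : ∀ {s u t l} → P s ≡ true → adj G s u ≡ true → s ∉ l → SimplePath G P u t l → SimplePath G P s t (s ∷ l)

module _ {G : Graph} {P : Fin (n G) → Bool} where

  SimplePath-from : ∀ {s u t l} → SimplePath G P u t l → s ∈ l → ∃[ l' ] SimplePath G P s t l'
  SimplePath-from p@(stop _) (here refl) = _ , p
  SimplePath-from p@(cons _ _ _ _) (here refl) = _ , p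
  SimplePath-from (cons _ _ _ p) (there s∈) = SimplePath-from p s∈

  -- Loop erasure: if `s` already lies on the path found for the rest of the walk, the part from `s`
  -- on is kept.
  simplePath : ∀ {s t} → ConnIn G P s t → ∃[ l ] SimplePath G P s t l
  simplePath (here p) = _ , stop p
  simplePath {s} (step p a c) with simplePath c
  ... | l , sp with s ∈? l
    where open import Data.List.Membership.DecPropositional _≟_ using (_∈?_)
  ... | yes s∈ = SimplePath-from sp s∈
  ... | no s∉ = _ , cons p a s∉ sp

  SimplePath-unique : ∀ {s t l} → SimplePath G P s t l → Unique l
  SimplePath-unique (stop _) = [] ∷ []
  SimplePath-unique (cons _ _ s∉ p) = All.tabulate (λ { i∈ refl → s∉ i∈ }) ∷ SimplePath-unique p

  SimplePath-all : ∀ {s t l} → SimplePath G P s t l → ∀ {i} → i ∈ l → P i ≡ true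
  SimplePath-all (stop p) (here refl) = p
  SimplePath-all (cons p _ _ _) (here refl) = p
  SimplePath-all (cons _ _ _ p) (there i∈) = SimplePath-all p i∈

  SimplePath-adj : ∀ {x s t l} → SimplePath G P s t l → adj G x s ≡ true →
    ∀ (i : Fin (length l)) → adj G (lookup (x ∷ l) (inject₁ i)) (lookup l i) ≡ true
  SimplePath-adj (stop _) a zero = a
  SimplePath-adj (cons _ _ _ _) a zero = a
  SimplePath-adj (cons _ a' _ p) a (suc i) = SimplePath-adj p a' i

  SimplePath-last : ∀ {s t y l} → SimplePath G P s t (y ∷ l) → lookup (y ∷ l) (fromℕ (length l)) ≡ t
  SimplePath-last (stop _) = refl
  SimplePath-last (cons _ _ _ p@(stop _)) = SimplePath-last p
  SimplePath-last (cons _ _ _ p@(cons _ _ _ _)) = SimplePath-last p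

lookup-injective : ∀ {A : Set} {xs : List A} → Unique xs → ∀ i j → lookup xs i ≡ lookup xs j → i ≡ j
lookup-injective (_ ∷ _) zero zero e = refl
lookup-injective (h ∷ _) zero (suc j) e = ⊥-elim (All.lookup h (∈-lookup j) e)
lookup-injective (h ∷ _) (suc i) zero e = ⊥-elim (All.lookup h (∈-lookup i) (≡-sym e))
lookup-injective (_ ∷ u) (suc i) (suc j) e = cong suc (lookup-injective u i j e)

-- If `y` and `z` were different, a simple path between them inside `P` would close up through `x`,
-- which lies outside `P`, to a cycle.
unique-attachment : ∀ {G} → ¬ HasCycle G → ∀ {P x y z} → P x ≡ false → ConnIn G P y z →
  adj G x y ≡ true → adj G x z ≡ true → y ≡ z
unique-attachment {G} acyclic {P} {x} Px c xy xz with simplePath c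
... | _ , stop _ = refl
... | _ , sp@(cons {s} {l = a ∷ l} _ _ _ sp') =
  ⊥-elim (acyclic (length l , lookup (x ∷ s ∷ a ∷ l) , (λ {i} {j} → lookup-injective uniq i j) , SimplePath-adj sp xy ,
    trans (cong (λ t → adj G t x) (SimplePath-last sp)) (trans (sym G _ _) xz)))
  where
  uniq : Unique (x ∷ s ∷ a ∷ l)
  uniq = All.tabulate (λ { i∈ refl → false≢true Px (SimplePath-all sp i∈) }) ∷ SimplePath-unique sp

-- A rooting of the subtree `S`: the unique lower neighbour of a vertex is its parent. It is
-- relative to `S` so that the tree can be built vertex by vertex, with `pos` as the time of
-- insertion.
record ParentOrder (T : Graph) (S : Fin (n T) → Bool) : Set where
  field
    pos          : Fin (n T) → ℕ
    bound        : ℕ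
    pos<bound    : ∀ {a} → S a ≡ true → pos a < bound
    connected    : ∀ {a b} → S a ≡ true → S b ≡ true → ConnIn T S a b
    pos-adj      : ∀ {a b} → S a ≡ true → S b ≡ true → adj T a b ≡ true → pos a ≢ pos b
    lower-unique : ∀ {a b c} → S a ≡ true → S b ≡ true → S c ≡ true → adj T a b ≡ true → adj T a c ≡ true →
                   pos b < pos a → pos c < pos a → b ≡ c

insert : ∀ {m} → Fin m → (Fin m → Bool) → Fin m → Bool
insert x S t = if ⌊ t ≟ x ⌋ then true else S t

insert-new : ∀ {m} (x : Fin m) S → insert x S x ≡ true
insert-new x S with x ≟ x
... | yes _ = refl
... | no x≢x = ⊥-elim (x≢x refl)

insert-old : ∀ {m} (x : Fin m) S i → S i ≡ true → insert x S i ≡ true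
insert-old x S i e with i ≟ x
... | yes _ = refl
... | no _ = e

insert⁻ : ∀ {m} (x : Fin m) S i → insert x S i ≡ true → i ≡ x ⊎ (i ≢ x × S i ≡ true)
insert⁻ x S i e with i ≟ x
... | yes e' = inj₁ e'
... | no ne = inj₂ (ne , e)

-- The new vertex gets the highest position, so it is below no old vertex, and acyclicity leaves it
-- a single neighbour in `S`.
grow : ∀ {T S} → ¬ HasCycle T → ∀ {x y} → S x ≡ false → S y ≡ true → adj T x y ≡ true →
  ParentOrder T S → ParentOrder T (insert x S)
grow {T} {S} acyclic {x} {y} Sx Sy xy o = record
  { pos = pos'
  ; bound = suc bound
  ; pos<bound = λ {a} Sa → pos'<bound (insert⁻ x S a Sa)
  ; connected = λ {a} {b} Sa Sb → conn (insert⁻ x S a Sa) (insert⁻ x S b Sb)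
  ; pos-adj = λ {a} {b} Sa Sb → pa (insert⁻ x S a Sa) (insert⁻ x S b Sb)
  ; lower-unique = λ {a} {b} {c} Sa Sb Sc → lu (insert⁻ x S a Sa) (insert⁻ x S b Sb) (insert⁻ x S c Sc)
  }
  where
  open ParentOrder o
  In : Fin (n T) → Set
  In a = a ≡ x ⊎ (a ≢ x × S a ≡ true)
  pos' : Fin (n T) → ℕ
  pos' t = if ⌊ t ≟ x ⌋ then bound else pos t
  pos'-new : pos' x ≡ bound
  pos'-new with x ≟ x
  ... | yes _ = refl
  ... | no x≢x = ⊥-elim (x≢x refl)
  pos'-old : ∀ {a} → a ≢ x → pos' a ≡ pos a
  pos'-old {a} ne with a ≟ x
  ... | yes e = ⊥-elim (ne e)
  ... | no _ = refl
  pos'-< : ∀ {a} → a ≢ x × S a ≡ true → pos' a < bound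
  pos'-< (ne , Sa) = subst (_< bound) (≡-sym (pos'-old ne)) (pos<bound Sa)
  pos'<bound : ∀ {a} → In a → pos' a < suc bound
  pos'<bound (inj₁ refl) = s≤s (≤-reflexive pos'-new)
  pos'<bound (inj₂ h) = m<n⇒m<1+n (pos'-< h)
  mono : ∀ {a b} → ConnIn T S a b → ConnIn T (insert x S) a b
  mono = ConnIn-mono (insert-old x S)
  new : insert x S x ≡ true
  new = insert-new x S
  yx : adj T y x ≡ true
  yx = trans (sym T _ _) xy
  conn : ∀ {a b} → In a → In b → ConnIn T (insert x S) a b
  conn (inj₁ refl) (inj₁ refl) = here new
  conn (inj₁ refl) (inj₂ (_ , Sb)) = step new xy (mono (connected Sy Sb))
  conn (inj₂ (_ , Sa)) (inj₁ refl) = ConnIn-snoc (mono (connected Sa Sy)) yx new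
  conn (inj₂ (_ , Sa)) (inj₂ (_ , Sb)) = mono (connected Sa Sb)
  pa : ∀ {a b} → In a → In b → adj T a b ≡ true → pos' a ≢ pos' b
  pa (inj₁ refl) (inj₁ refl) ab e = false≢true (irrefl T _) ab
  pa (inj₁ refl) (inj₂ h) ab e = <-irrefl (≡-sym (trans (≡-sym pos'-new) e)) (pos'-< h)
  pa (inj₂ h) (inj₁ refl) ab e = <-irrefl (trans e pos'-new) (pos'-< h)
  pa (inj₂ (p , q)) (inj₂ (r , s)) ab e = pos-adj q s ab (trans (≡-sym (pos'-old p)) (trans e (pos'-old r)))
  ¬new< : ∀ {a} → In a → ¬ (pos' x < pos' a)
  ¬new< {a} i lt = <-irrefl refl (<-≤-trans lt (subst (pos' a ≤_) (≡-sym pos'-new) (s≤s⁻¹ (pos'<bound i))))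
  lu : ∀ {a b c} → In a → In b → In c → adj T a b ≡ true → adj T a c ≡ true →
       pos' b < pos' a → pos' c < pos' a → b ≡ c
  lu i (inj₁ refl) _ _ _ p q = ⊥-elim (¬new< i p)
  lu i (inj₂ _) (inj₁ refl) _ _ p q = ⊥-elim (¬new< i q)
  lu (inj₁ refl) (inj₂ (_ , Sb)) (inj₂ (_ , Sc)) ab ac p q = unique-attachment acyclic Sx (connected Sb Sc) ab ac
  lu (inj₂ (na , Sa)) (inj₂ (nb , Sb)) (inj₂ (nc , Sc)) ab ac p q =
    lower-unique Sa Sb Sc ab ac (subst₂ _<_ (pos'-old nb) (pos'-old na) p) (subst₂ _<_ (pos'-old nc) (pos'-old na) q)

-- The fuel exceeds the number of vertices outside `S`. Once no edge leaves `S`, connectedness of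
-- `T` makes `S` everything.
growAll : ∀ {T} → Connected T → ¬ HasCycle T → ∀ {r} fuel (S : Fin (n T) → Bool) → count (not ∘ S) < fuel →
  S r ≡ true → ParentOrder T S → ∃[ S' ] ParentOrder T S' × (∀ t → S' t ≡ true)
growAll {T} conn acyclic {r} (suc fuel) S lt Sr o
  with Fin.any? (λ x → Fin.any? (λ y → S x Bool.≟ false ×-dec S y Bool.≟ true ×-dec adj T x y Bool.≟ true))
... | yes (x , y , Sx , Sy , xy) = growAll conn acyclic fuel (insert x S)
  (<-≤-trans (count-mono-< {p = not ∘ insert x S} {q = not ∘ S} h (cong not (insert-new x S)) (cong not Sx)) (s≤s⁻¹ lt))
  (insert-old x S r Sr) (grow acyclic Sx Sy xy o)
  where
  h : ∀ i → not (insert x S i) ≡ true → not (S i) ≡ true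
  h i e with i ≟ x
  ... | no _ = e
... | no none = S , o , λ t → go (conn r t) Sr
  where
  go : ∀ {s t} → ConnIn T (λ _ → true) s t → S s ≡ true → S t ≡ true
  go (here _) Ss = Ss
  go (step {s} {u} _ a c) Ss with S u Bool.≟ true
  ... | yes Su = go c Su
  ... | no ¬Su = ⊥-elim (none (u , s , Bool.¬-not ¬Su , Ss , trans (sym T _ _) a))

tree-ParentOrder : ∀ {T} → IsTree T → ∃[ S ] ParentOrder T S × (∀ t → S t ≡ true)
tree-ParentOrder {T} (0<n , conn , acyclic) = growAll conn acyclic _ (insert r (λ _ → false)) ≤-refl (insert-new r _) record
  { pos = λ _ → 0
  ; bound = 1
  ; pos<bound = λ _ → s≤s z≤n
  ; connected = λ Sa Sb → subst₂ (ConnIn T _) (≡-sym (only Sa)) (≡-sym (only Sb)) (here (insert-new r _))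
  ; pos-adj = λ Sa Sb ab → ⊥-elim (false≢true (irrefl T r) (subst₂ (λ a b → adj T a b ≡ true) (only Sa) (only Sb) ab))
  ; lower-unique = λ _ Sb Sc _ _ _ _ → trans (only Sb) (≡-sym (only Sc))
  }
  where
  r : Fin (n T)
  r = fromℕ< 0<n
  only : ∀ {a} → insert r (λ _ → false) a ≡ true → a ≡ r
  only {a} e with insert⁻ r (λ _ → false) a e
  ... | inj₁ eq = eq

-- Elimination orders from tree decompositions

-- A perfect elimination order of a chordal supergraph, in which the later elements of `top v` are
-- the later neighbours of `v`; by `top-meet` they form a clique. `top v` may contain earlier
-- vertices as well.
record EliminationOrder (G : Graph) (k : ℕ) : Set where
  field
    -- Vertices with larger keys come earlier.
    key      : Fin (n G) → ℕ
    key-inj  : ∀ {u v} → key u ≡ key v → u ≡ v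
    top      : Fin (n G) → Fin (n G) → Bool
    top-size : ∀ v → count (top v) ≤ suc k
    top-self : ∀ v → top v v ≡ true
    top-adj  : ∀ {u v} → adj G u v ≡ true → key v ≤ key u → top u v ≡ true
    top-meet : ∀ {u v w} → top u v ≡ true → top u w ≡ true → key w ≤ key v → top v w ≡ true

module _ {G : Graph} (D : TreeDecomposition G) where
  open TreeDecomposition D renaming (edge to bag-edge)

  module _ {S : Fin (n T) → Bool} (o : ParentOrder T S) (all : ∀ t → S t ≡ true) where
    open ParentOrder o

    data Descent (P : Fin (n T) → Bool) : Fin (n T) → Fin (n T) → Set where
      stop : ∀ {t} → P t ≡ true → Descent P t t
      down : ∀ {s u t} → P s ≡ true → adj T s u ≡ true → pos u < pos s → Descent P u t → Descent P s t

    Descent-pos : ∀ {P s t} → Descent P s t → pos t ≤ pos s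
    Descent-pos (stop _) = ≤-refl
    Descent-pos (down _ _ lt d) = ≤-trans (Descent-pos d) (<⇒≤ lt)

    Descent-start : ∀ {P s t} → Descent P s t → P s ≡ true
    Descent-start (stop p) = p
    Descent-start (down p _ _ _) = p

    -- A walk that first goes up from s to u and then descends has to come back through s, the only lower neighbour of u.
    descent : ∀ {P s t} → (∀ i → P i ≡ true → pos t ≤ pos i) → ConnIn T P s t → Descent P s t
    descent low (here p) = stop p
    descent low (step {s} {u} p a c) with <-cmp (pos u) (pos s)
    ... | tri< lt _ _ = down p a lt (descent low c)
    ... | tri≈ _ e _ = ⊥-elim (pos-adj (all _) (all _) a (≡-sym e))
    ... | tri> _ _ lt with descent low c
    ... | stop _ = ⊥-elim (<⇒≱ lt (low s p))
    ... | down _ a' lt' d with lower-unique (all _) (all _) (all _) (trans (sym T _ _) a) a' lt lt'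
    ... | refl = d

    -- Both descents start at `s` and follow parents, so the one that ends lower passes through the
    -- end of the other.
    descent-meet : ∀ {P Q s t t'} → Descent P s t → Descent Q s t' → pos t' ≤ pos t → Q t ≡ true
    descent-meet (stop _) d le = Descent-start d
    descent-meet (down _ _ lt d) (stop _) le = ⊥-elim (<⇒≱ lt (≤-trans le (Descent-pos d)))
    descent-meet (down _ a lt d) (down _ a' lt' d') le
      with refl ← lower-unique (all _) (all _) (all _) a a' lt lt' = descent-meet d d' le

    lowest : ∀ v → ∃[ t ] bag t v ≡ true × (∀ i → bag i v ≡ true → pos t ≤ pos i)
    lowest v = exists-argmin (λ t → bag t v Bool.≟ true) pos (cover v)

    root : Fin (n G) → Fin (n T)
    root v = proj₁ (lowest v)

    root-bag : ∀ v → bag (root v) v ≡ true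
    root-bag v = proj₁ (proj₂ (lowest v))

    -- The lexicographic order on pairs (position of the root, index) in a single number; the index
    -- breaks ties.
    rootKey : Fin (n G) → ℕ
    rootKey v = pos (root v) * n G + toℕ v

    rootKey-mono : ∀ {u v} → rootKey u ≤ rootKey v → pos (root u) ≤ pos (root v)
    rootKey-mono {u} {v} le with pos (root u) ≤? pos (root v)
    ... | yes h = h
    ... | no h = ⊥-elim (<⇒≱ lt le)
      where
      open ≤-Reasoning
      lt : rootKey v < rootKey u
      lt = begin-strict
        pos (root v) * n G + toℕ v   <⟨ +-monoʳ-< _ (Fin.toℕ<n v) ⟩
        pos (root v) * n G + n G     ≡⟨ +-comm _ (n G) ⟩
        suc (pos (root v)) * n G     ≤⟨ *-monoˡ-≤ (n G) (≰⇒> h) ⟩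
        pos (root u) * n G           ≤⟨ m≤m+n _ _ ⟩
        rootKey u                    ∎

    -- From the shared bag `s` one can descend through bags of `v` to its root and through bags of
    -- `w` to its root. The latter is at most as high, so the descent for `w` meets the root of `v`.
    root-meet : ∀ {s v w} → bag s v ≡ true → bag s w ≡ true → rootKey w ≤ rootKey v → bag (root v) w ≡ true
    root-meet {s} {v} {w} sv sw le = descent-meet
      (descent (proj₂ (proj₂ (lowest v))) (subtree v s (root v) sv (root-bag v)))
      (descent (proj₂ (proj₂ (lowest w))) (subtree w s (root w) sw (root-bag w)))
      (rootKey-mono le)

    eliminationOrder' : EliminationOrder G (width D)
    eliminationOrder' = record
      { key = rootKey
      ; key-inj = λ {u} {v} e → Fin.toℕ-injective (+-cancelˡ-≡ (pos (root u) * n G) _ _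
          (trans e (cong (λ p → p * n G + toℕ v)
            (≤-antisym (rootKey-mono (≤-reflexive (≡-sym e))) (rootKey-mono (≤-reflexive e))))))
      ; top = bag ∘ root
      ; top-size = λ v → ≤-trans (≤-maxFin (λ t → count (bag t)) (root v)) (m≤n+m∸n _ 1)
      ; top-self = root-bag
      ; top-adj = λ uv le → let (_ , su , sv) = bag-edge _ _ uv in root-meet su sv le
      ; top-meet = λ uv uw le → root-meet uv uw le
      }

  eliminationOrder : EliminationOrder G (width D)
  eliminationOrder = let (_ , o , all) = tree-ParentOrder isTree in eliminationOrder' o all

-- Partial edge colourings

∧-true : ∀ {a b} → a ∧ b ≡ true → a ≡ true × b ≡ true
∧-true {true} {true} _ = refl , refl

∧-intro : ∀ {a b} → a ≡ true → b ≡ true → a ∧ b ≡ true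
∧-intro refl refl = refl

true⊎false : ∀ b → b ≡ true ⊎ b ≡ false
true⊎false true = inj₁ refl
true⊎false false = inj₂ refl

⌊⌋-true : ∀ {P : Set} (d : Dec P) → ⌊ d ⌋ ≡ true → P
⌊⌋-true (yes p) _ = p

⌊⌋-intro : ∀ {P : Set} (d : Dec P) → P → ⌊ d ⌋ ≡ true
⌊⌋-intro (yes p) _ = refl
⌊⌋-intro (no ¬p) p = ⊥-elim (¬p p)

⌊⌋-false : ∀ {P : Set} (d : Dec P) → ¬ P → ⌊ d ⌋ ≡ false
⌊⌋-false (yes p) ¬p = ⊥-elim (¬p p)
⌊⌋-false (no _) _ = refl

colours-covered : ∀ {D} (L : List (Maybe (Fin D))) → (∀ c → c ∈ L) → suc D ≤ length L
colours-covered {D} L h = subst (_≤ length L) (cong suc (trans (length-map just (allFin D)) (length-tabulate id)))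
  (length-≤-⊆ (All.tabulate (λ { i∈ refl → nothing∉ i∈ }) ∷ Unique.map⁺ Maybe.just-injective (allFin⁺ D)) (λ {a} _ → h a))
  where
  nothing∉ : nothing ∉ map just (allFin D)
  nothing∉ i∈ with ∈-map⁻ just i∈
  ... | _ , _ , ()

-- One entry of `L` is spent on `nothing`, so fewer than `D` entries are colours.
free-colour : ∀ {D} (L : List (Maybe (Fin D))) → nothing ∈ L → length L ≤ D → ∃[ c ] just c ∉ L
free-colour {D} L n∈ le with Fin.any? (λ c → ¬? (just c ∈? L))
  where open import Data.List.Membership.DecPropositional (Maybe.≡-dec (_≟_ {D})) using (_∈?_)
... | yes h = h
... | no ¬h = ⊥-elim (<⇒≱ (colours-covered L all) le)
  where
  open import Data.List.Membership.DecPropositional (Maybe.≡-dec (_≟_ {D})) using (_∈?_)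
  all : ∀ c → c ∈ L
  all nothing = n∈
  all (just c) with just c ∈? L
  ... | yes c∈ = c∈
  ... | no c∉ = ⊥-elim (¬h (c , c∉))

two-elements : ∀ {A : Set} {xs : List A} → Unique xs → 2 ≤ length xs → ∃[ x ] ∃[ y ] x ≢ y × x ∈ xs × y ∈ xs
two-elements {xs = x ∷ y ∷ _} ((x≢y ∷ _) ∷ _) _ = x , y , x≢y , here refl , there (here refl)
two-elements {xs = _ ∷ []} _ (s≤s ())

SameEdge : ∀ {m} → Fin m → Fin m → Fin m → Fin m → Set
SameEdge a b p q = (p ≡ a × q ≡ b) ⊎ (p ≡ b × q ≡ a)

sameEdge? : ∀ {m} (a b p q : Fin m) → Dec (SameEdge a b p q)
sameEdge? a b p q = ((p ≟ a) ×-dec (q ≟ b)) ⊎-dec ((p ≟ b) ×-dec (q ≟ a))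

SameEdge-sym : ∀ {m} {a b p q : Fin m} → SameEdge a b p q → SameEdge a b q p
SameEdge-sym (inj₁ (h , h')) = inj₂ (h' , h)
SameEdge-sym (inj₂ (h , h')) = inj₁ (h' , h)

outerNbr : ∀ G → Fin (n G) → (Fin (n G) → Bool) → Fin (n G) → Bool
outerNbr G v W u = adj G v u ∧ not (W u)

-- The situation around the chosen vertex `v`. The vertex colours are fixed here and only edges are
-- recoloured; `3k≤3+D` is D ≥ 3k - 3 without truncated subtraction.
module Recolouring (G : Graph) (k D : ℕ) (3≤k : 3 ≤ k) (3k≤3+D : k + (k + k) ≤ 3 + D)
  (v : Fin (n G)) (deg-v : count (adj G v) ≤ D)
  (W : Fin (n G) → Bool) (v∉W : W v ≡ false) (W-size : count W ≤ k)
  (U-degree : ∀ {u} → outerNbr G v W u ≡ true → count (adj G u) ≤ k)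
  (U-nbr : ∀ {u w} → outerNbr G v W u ≡ true → adj G u w ≡ true → w ≡ v ⊎ W w ≡ true)
  (vcol : Fin (n G) → Fin (suc D))
  where

  V Colour : Set
  V = Fin (n G)
  Colour = Fin (suc D)

  U : V → Bool
  U = outerNbr G v W

  EdgeColouring : Set
  EdgeColouring = V → V → Maybe Colour

  -- The vertices of U count as uncoloured.
  record Proper (e : EdgeColouring) : Set where
    field
      e-sym  : ∀ p q → e p q ≡ e q p
      supp   : ∀ {p q c} → e p q ≡ just c → adj G p q ≡ true
      proper : ∀ {p q r c} → e p q ≡ just c → e p r ≡ just c → q ≡ r
      vert   : ∀ {p q c} → e p q ≡ just c → U p ≡ false → c ≢ vcol p

  Miss : EdgeColouring → V → Colour → Set
  Miss e p c = ∀ q → e p q ≢ just c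

  Full : Set
  Full = ∃[ e ] Proper e × (∀ p q → adj G p q ≡ true → e p q ≢ nothing)

  record Hole (x : V) (e : EdgeColouring) : Set where
    field
      isProper : Proper e
      x∈U      : U x ≡ true
      hole     : e v x ≡ nothing
      only     : ∀ {p q} → adj G p q ≡ true → e p q ≡ nothing → SameEdge v x p q
    open Proper isProper public

  U-W : ∀ {u} → U u ≡ true → W u ≡ false
  U-W {u} h with W u | ∧-true {adj G v u} h
  ... | false | _ = refl

  U-adj : ∀ {u} → U u ≡ true → adj G v u ≡ true
  U-adj h = proj₁ (∧-true h)

  v∉U : U v ≡ false
  v∉U = cong (_∧ not (W v)) (irrefl G v)

  U≢v : ∀ {u} → U u ≡ true → u ≢ v
  U≢v h refl = false≢true v∉U h

  U≢W : ∀ {u w} → U u ≡ true → W w ≡ true → u ≢ w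
  U≢W p q refl = false≢true (U-W p) q

  W≢v : ∀ {w} → W w ≡ true → w ≢ v
  W≢v h refl = false≢true v∉W h

  nbr-of-v : ∀ {w} → adj G v w ≡ true → W w ≡ true ⊎ U w ≡ true
  nbr-of-v {w} a with W w
  ... | true = inj₁ refl
  ... | false = inj₂ (∧-intro a refl)

  finish : ∀ {x e b} → Hole x e → Miss e v b → b ≢ vcol v → Miss e x b → Full
  finish {x} {e} {b} st mv bv mx = e' , record { e-sym = e'-sym ; supp = e'-supp ; proper = e'-proper ; vert = e'-vert } , full
    where
    open Hole st
    e' : EdgeColouring
    e' p q = if ⌊ sameEdge? v x p q ⌋ then just b else e p q
    e'-sym : ∀ p q → e' p q ≡ e' q p
    e'-sym p q with sameEdge? v x p q | sameEdge? v x q p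
    ... | yes _ | yes _ = refl
    ... | yes m | no ¬m = ⊥-elim (¬m (SameEdge-sym m))
    ... | no ¬m | yes m = ⊥-elim (¬m (SameEdge-sym m))
    ... | no _ | no _ = e-sym p q
    e'-supp : ∀ {p q c} → e' p q ≡ just c → adj G p q ≡ true
    e'-supp {p} {q} h with sameEdge? v x p q
    ... | yes (inj₁ (refl , refl)) = U-adj x∈U
    ... | yes (inj₂ (refl , refl)) = trans (sym G _ _) (U-adj x∈U)
    ... | no _ = supp h
    ¬match : ∀ {p q r c} → SameEdge v x p q → just b ≡ just c → e p r ≢ just c
    ¬match (inj₁ (refl , refl)) refl = mv _
    ¬match (inj₂ (refl , refl)) refl = mx _
    e'-proper : ∀ {p q r c} → e' p q ≡ just c → e' p r ≡ just c → q ≡ r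
    e'-proper {p} {q} {r} h h' with sameEdge? v x p q | sameEdge? v x p r
    ... | yes (inj₁ (_ , refl)) | yes (inj₁ (_ , refl)) = refl
    ... | yes (inj₂ (_ , refl)) | yes (inj₂ (_ , refl)) = refl
    ... | yes (inj₁ (refl , _)) | yes (inj₂ (refl , _)) = ⊥-elim (U≢v x∈U refl)
    ... | yes (inj₂ (refl , _)) | yes (inj₁ (refl , _)) = ⊥-elim (U≢v x∈U refl)
    ... | yes m | no _ = ⊥-elim (¬match m h h')
    ... | no _ | yes m = ⊥-elim (¬match m h' h)
    ... | no _ | no _ = proper h h'
    e'-vert : ∀ {p q c} → e' p q ≡ just c → U p ≡ false → c ≢ vcol p
    e'-vert {p} {q} h ¬u with sameEdge? v x p q
    e'-vert refl ¬u | yes (inj₁ (refl , _)) = bv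
    e'-vert refl ¬u | yes (inj₂ (refl , _)) = ⊥-elim (false≢true ¬u x∈U)
    e'-vert h ¬u | no _ = vert h ¬u
    full : ∀ p q → adj G p q ≡ true → e' p q ≢ nothing
    full p q a h with sameEdge? v x p q
    full p q a () | yes _
    ... | no ¬m = ¬m (only a h)

  -- Exchanges the colours of wP and wQ for every w in Z.
  module Exchange (P Q : V) (P≢Q : P ≢ Q) (Z : V → Bool) (P∉Z : Z P ≡ false) (Q∉Z : Z Q ≡ false)
    (e : EdgeColouring) (e-proper : Proper e) where
    open Proper e-proper

    σ : V → V
    σ p = if ⌊ p ≟ P ⌋ then Q else if ⌊ p ≟ Q ⌋ then P else p

    σ-P : σ P ≡ Q
    σ-P with P ≟ P
    ... | yes _ = refl
    ... | no h = ⊥-elim (h refl)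

    σ-Q : σ Q ≡ P
    σ-Q with Q ≟ P | Q ≟ Q
    ... | yes h | _ = ⊥-elim (P≢Q (≡-sym h))
    ... | no _ | yes _ = refl
    ... | no _ | no h = ⊥-elim (h refl)

    σ-other : ∀ {p} → p ≢ P → p ≢ Q → σ p ≡ p
    σ-other {p} h h' with p ≟ P | p ≟ Q
    ... | yes e | _ = ⊥-elim (h e)
    ... | no _ | yes e = ⊥-elim (h' e)
    ... | no _ | no _ = refl

    data View : V → Set where
      isP : View P
      isQ : View Q
      other : ∀ {p} → p ≢ P → p ≢ Q → View p

    view : ∀ p → View p
    view p with p ≟ P | p ≟ Q
    ... | yes refl | _ = isP
    ... | no _ | yes refl = isQ
    ... | no h | no h' = other h h'

    σσ : ∀ p → σ (σ p) ≡ p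
    σσ p with view p
    ... | isP = trans (cong σ σ-P) σ-Q
    ... | isQ = trans (cong σ σ-Q) σ-P
    ... | other h h' = trans (cong σ (σ-other h h')) (σ-other h h')

    σ-Z : ∀ {w} → Z w ≡ true → σ w ≡ w
    σ-Z h = σ-other (λ { refl → false≢true P∉Z h }) (λ { refl → false≢true Q∉Z h })

    -- `σ` fixes `Z`, since neither `P` nor `Q` lies in it. Applying it to both arguments therefore
    -- swaps the rows of `P` and `Q` over `Z` and keeps the table symmetric.
    exchange : EdgeColouring
    exchange p q = if Z p ∨ Z q then e (σ p) (σ q) else e p q

    exchange-sym : ∀ p q → exchange p q ≡ exchange q p
    exchange-sym p q rewrite Bool.∨-comm (Z p) (Z q) | e-sym p q | e-sym (σ p) (σ q) = refl

    exchange-row : ∀ {w} → Z w ≡ true → ∀ q → exchange w q ≡ e w (σ q)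
    exchange-row {w} h q rewrite h | σ-Z h = refl

    exchange-col : ∀ {w} → Z w ≡ true → ∀ p → exchange p w ≡ e (σ p) w
    exchange-col h p = trans (exchange-sym p _) (trans (exchange-row h p) (e-sym _ _))

    exchange-out : ∀ {p q} → Z p ≡ false → Z q ≡ false → exchange p q ≡ e p q
    exchange-out h h' rewrite h | h' = refl

    exchange-other : ∀ {p} → p ≢ P → p ≢ Q → Z p ≡ false → ∀ q → exchange p q ≡ e p q
    exchange-other {p} h h' zp q with true⊎false (Z q)
    ... | inj₁ zq = trans (exchange-col zq p) (cong (λ s → e s q) (σ-other h h'))
    ... | inj₂ zq = exchange-out zp zq

    -- A colour arriving at `P` must not occur at `P` outside `Z`, must avoid the vertex colour of
    -- `P` unless `P` is in `U`, and must land on an edge; likewise for `Q`. Over `Z` the whole row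
    -- is replaced, so no clash arises there.
    module _
      (okP : ∀ {w c} → Z w ≡ true → e Q w ≡ just c →
             (∀ z → Z z ≡ false → e P z ≢ just c) × (U P ≡ false → c ≢ vcol P) × adj G P w ≡ true)
      (okQ : ∀ {w c} → Z w ≡ true → e P w ≡ just c →
             (∀ z → Z z ≡ false → e Q z ≢ just c) × (U Q ≡ false → c ≢ vcol Q) × adj G Q w ≡ true)
      where

      module Row (A B : V) (A∉Z : Z A ≡ false) (σA : σ A ≡ B)
        (okA : ∀ {w c} → Z w ≡ true → e B w ≡ just c →
             (∀ z → Z z ≡ false → e A z ≢ just c) × (U A ≡ false → c ≢ vcol A) × adj G A w ≡ true) where

        inZ : ∀ {y} → Z y ≡ true → exchange A y ≡ e B y
        inZ h = trans (exchange-col h A) (cong (λ s → e s _) σA)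

        outZ : ∀ {y} → Z y ≡ false → exchange A y ≡ e A y
        outZ h = exchange-out A∉Z h

        row-supp : ∀ {q c} → exchange A q ≡ just c → adj G A q ≡ true
        row-supp {q} h with true⊎false (Z q)
        ... | inj₁ zq = proj₂ (proj₂ (okA zq (trans (≡-sym (inZ zq)) h)))
        ... | inj₂ zq = supp (trans (≡-sym (outZ zq)) h)

        row-proper : ∀ {q r c} → exchange A q ≡ just c → exchange A r ≡ just c → q ≡ r
        row-proper {q} {r} h h' with true⊎false (Z q) | true⊎false (Z r)
        ... | inj₁ zq | inj₁ zr = proper (trans (≡-sym (inZ zq)) h) (trans (≡-sym (inZ zr)) h')
        ... | inj₁ zq | inj₂ zr = ⊥-elim (proj₁ (okA zq (trans (≡-sym (inZ zq)) h)) r zr (trans (≡-sym (outZ zr)) h'))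
        ... | inj₂ zq | inj₁ zr = ⊥-elim (proj₁ (okA zr (trans (≡-sym (inZ zr)) h')) q zq (trans (≡-sym (outZ zq)) h))
        ... | inj₂ zq | inj₂ zr = proper (trans (≡-sym (outZ zq)) h) (trans (≡-sym (outZ zr)) h')

        row-vert : ∀ {q c} → exchange A q ≡ just c → U A ≡ false → c ≢ vcol A
        row-vert {q} h with true⊎false (Z q)
        ... | inj₁ zq = proj₁ (proj₂ (okA zq (trans (≡-sym (inZ zq)) h)))
        ... | inj₂ zq = vert (trans (≡-sym (outZ zq)) h)

      exchange-proper : Proper exchange
      exchange-proper = record
        { e-sym = exchange-sym
        ; supp = λ {p} {q} → x-supp p q
        ; proper = λ {p} → x-proper p
        ; vert = λ {p} → x-vert p
        }
        where
        module RP = Row P Q P∉Z σ-P okP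
        module RQ = Row Q P Q∉Z σ-Q okQ

        x-proper : ∀ p {q r c} → exchange p q ≡ just c → exchange p r ≡ just c → q ≡ r
        x-proper p h h' with view p
        ... | isP = RP.row-proper h h'
        ... | isQ = RQ.row-proper h h'
        ... | other a b with true⊎false (Z p)
        ... | inj₂ zp = proper (trans (≡-sym (exchange-other a b zp _)) h) (trans (≡-sym (exchange-other a b zp _)) h')
        -- A row in `Z` is permuted by the involution `σ`, so properness carries over.
        ... | inj₁ zp = trans (≡-sym (σσ _)) (trans (cong σ (proper (trans (≡-sym (exchange-row zp _)) h)
            (trans (≡-sym (exchange-row zp _)) h'))) (σσ _))

        x-vert : ∀ p {q c} → exchange p q ≡ just c → U p ≡ false → c ≢ vcol p
        x-vert p h with view p
        ... | isP = RP.row-vert h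
        ... | isQ = RQ.row-vert h
        ... | other a b with true⊎false (Z p)
        ... | inj₂ zp = vert (trans (≡-sym (exchange-other a b zp _)) h)
        ... | inj₁ zp = vert (trans (≡-sym (exchange-row zp _)) h)

        x-supp : ∀ p q {c} → exchange p q ≡ just c → adj G p q ≡ true
        x-supp p q h with view p | view q
        ... | isP | _ = RP.row-supp h
        ... | isQ | _ = RQ.row-supp h
        ... | other _ _ | isP = trans (sym G _ _) (RP.row-supp (trans (exchange-sym _ _) h))
        ... | other _ _ | isQ = trans (sym G _ _) (RQ.row-supp (trans (exchange-sym _ _) h))
        ... | other a b | other a' b' with true⊎false (Z p)
        ... | inj₂ zp = supp (trans (≡-sym (exchange-other a b zp _)) h)
        ... | inj₁ zp = supp (trans (≡-sym (trans (exchange-row zp q) (cong (e p) (σ-other a' b')))) h)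

  -- Free vertices and ways to finish

  e-diag : ∀ {e} → Proper e → ∀ p → e p p ≡ nothing
  e-diag {e} pr p with e p p in eq
  ... | nothing = refl
  ... | just c = ⊥-elim (false≢true (irrefl G p) (Proper.supp pr eq))

  -- Comparing `Maybe` values makes `vq` coloured as well when `e` is proper: the diagonal entry
  -- `e x x` is `nothing`, so `e v q` is not.
  Free : EdgeColouring → V → V → Set
  Free e x q = ∀ z → e x z ≢ e v q

  free? : ∀ e x q → Dec (Free e x q)
  free? e x q = Fin.all? (λ z → ¬? (Maybe.≡-dec _≟_ (e x z) (e v q)))

  free-colour-of : ∀ {e x q} → Proper e → Free e x q → ∃[ c ] e v q ≡ just c × Miss e x c
  free-colour-of {e} {x} {q} pr f with e v q in eq
  ... | just c = c , refl , f
  ... | nothing = ⊥-elim (f x (e-diag pr x))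

  Miss→Free : ∀ e x {q c} → e v q ≡ just c → Miss e x c → Free e x q
  Miss→Free e x eq m z h = m z (trans h eq)

  only-at : V → V → Bool
  only-at a p = ⌊ p ≟ a ⌋

  -- The colour of vy moves to vx.
  module Transfer {x e} (st : Hole x e) {y} (y∈U : U y ≡ true) (free : Free e x y) where
    open Hole st

    private
      c : Colour
      c = proj₁ (free-colour-of isProper free)
      evy : e v y ≡ just c
      evy = proj₁ (proj₂ (free-colour-of isProper free))

    x≢y : x ≢ y
    x≢y refl = free x (trans (e-diag isProper x) (≡-sym hole))

    -- Moving the colour is the exchange of the rows of `x` and `y` over the single vertex `v`: the
    -- hole travels to `vy`.
    open Exchange x y x≢y (only-at v) (⌊⌋-false (x ≟ v) (U≢v x∈U)) (⌊⌋-false (y ≟ v) (U≢v y∈U)) e isProper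
      renaming (exchange to e₁) public

    v-in : only-at v v ≡ true
    v-in = ⌊⌋-intro (v ≟ v) refl

    proper₁ : Proper e₁
    proper₁ = exchange-proper
      (λ {w} {d} h h' → (λ z _ h″ → free z (trans h″ (trans (≡-sym h') (at h)))) ,
                    (λ h″ → ⊥-elim (false≢true h″ x∈U)) ,
                    subst (λ w → adj G x w ≡ true) (≡-sym (⌊⌋-true (w ≟ v) h)) (trans (sym G _ _) (U-adj x∈U)))
      -- No colour arrives at `y`, because `xv` is the hole.
      (λ {w} h h' → ⊥-elim (just≢nothing (trans (≡-sym h') (subst (λ w → e x w ≡ nothing) (≡-sym (⌊⌋-true (w ≟ v) h)) exv))))
      where
      just≢nothing : ∀ {d} → just d ≢ nothing {A = Colour}
      just≢nothing ()
      exv : e x v ≡ nothing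
      exv = trans (e-sym x v) hole
      at : ∀ {w} → only-at v w ≡ true → e y w ≡ e v y
      at {w} h = trans (cong (e y) (⌊⌋-true (w ≟ v) h)) (e-sym y v)

    row-v : ∀ q → e₁ v q ≡ e v (σ q)
    row-v = exchange-row v-in

    Miss-v : ∀ {b} → Miss e v b → Miss e₁ v b
    Miss-v m q h = m (σ q) (trans (≡-sym (row-v q)) h)

    row-v-other : ∀ {q} → q ≢ x → q ≢ y → e₁ v q ≡ e v q
    row-v-other h h' = trans (row-v _) (cong (e v) (σ-other h h'))

    row-v-x : e₁ v x ≡ e v y
    row-v-x = trans (row-v x) (cong (e v) σ-P)

    row-v-y : e₁ v y ≡ nothing
    row-v-y = trans (row-v y) (trans (cong (e v) σ-Q) hole)

    row-other : ∀ {p q} → p ≢ v → q ≢ v → e₁ p q ≡ e p q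
    row-other h h' = exchange-out (⌊⌋-false (_ ≟ v) h) (⌊⌋-false (_ ≟ v) h')

    hole₁ : Hole y e₁
    hole₁ = record { isProper = proper₁ ; x∈U = y∈U ; hole = row-v-y ; only = only₁ _ _ }
      where
      at-v : ∀ q → adj G v q ≡ true → e₁ v q ≡ nothing → q ≡ y
      at-v q a h with view q | trans (≡-sym (row-v q)) h
      ... | isP | h' with () ← trans (≡-sym (trans (cong (e v) σ-P) evy)) h'
      ... | isQ | _ = refl
      ... | other n n' | h' with only a (trans (≡-sym (cong (e v) (σ-other n n'))) h')
      ... | inj₁ (_ , r) = ⊥-elim (n r)
      ... | inj₂ (r , _) = ⊥-elim (U≢v x∈U (≡-sym r))
      only₁ : ∀ p q → adj G p q ≡ true → e₁ p q ≡ nothing → (p ≡ v × q ≡ y) ⊎ (p ≡ y × q ≡ v)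
      only₁ p q a h = go (p ≟ v) (q ≟ v)
        where
        go : Dec (p ≡ v) → Dec (q ≡ v) → (p ≡ v × q ≡ y) ⊎ (p ≡ y × q ≡ v)
        go (yes refl) _ = inj₁ (refl , at-v q a h)
        go (no _) (yes refl) = inj₂ (at-v p (trans (sym G _ _) a) (trans (exchange-sym _ _) h) , refl)
        go (no n) (no n') with only a (trans (≡-sym (row-other n n')) h)
        ... | inj₁ (r , _) = ⊥-elim (n r)
        ... | inj₂ (_ , r) = ⊥-elim (n' r)

    Miss₁ : ∀ {p c} → p ≢ v → (∀ z → z ≢ v → e p z ≢ just c) → e₁ p v ≢ just c → Miss e₁ p c
    Miss₁ {p} {c} p≢v m m' z = go (z ≟ v)
      where
      go : Dec (z ≡ v) → e₁ p z ≢ just c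
      go (yes refl) = m'
      go (no n) h = m z n (trans (≡-sym (row-other p≢v n)) h)

  -- The move permutes the row of `v`, so `b` is still missing there, and `y` only loses a colour;
  -- hence `b` fits on `vy`.
  transfer-finish : ∀ {x e y b} → Hole x e → U y ≡ true → Free e x y →
    Miss e v b → b ≢ vcol v → Miss e y b → Full
  transfer-finish {x} {e} {y} {b} st y∈U free mv bv my =
    finish hole₁ (Miss-v mv) bv (Miss₁ (U≢v y∈U) (λ z _ → my z) λ h → nothing≢just (trans (≡-sym (trans (exchange-sym _ _) row-v-y)) h))
    where
    open Transfer st y∈U free
    nothing≢just : nothing ≢ just b
    nothing≢just ()

  -- Exchanging the rows of v and x on Z makes the colour of vw miss at v; it goes to vy, whose own colour goes to vx.
  exchange-finish : ∀ {x e y w} → Hole x e → (Z : V → Bool) → (∀ {w} → Z w ≡ true → W w ≡ true) →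
    (∀ {w} → Z w ≡ true → ∃[ c ] e x w ≡ just c × c ≢ vcol v × (∀ z → Z z ≡ false → e v z ≢ just c)) →
    (∀ {w} → Z w ≡ true → ∃[ c ] e v w ≡ just c × (∀ z → Z z ≡ false → e x z ≢ just c)) →
    Z w ≡ true → Free e x w → U y ≡ true → Free e x y → Free e y w → Full
  exchange-finish {x} {e} {y} {w} st Z Z⊆W hx hv Zw fxw y∈U fxy fyw
    with free-colour-of (Hole.isProper st) fxw | free-colour-of (Hole.isProper st) fxy
  ... | β , evw , mx | c , evy , mxy =
    transfer-finish hole₂ y∈U free₂ miss-v (λ β≡ → vert evw v∉U β≡) miss-y
    where
    open Hole st
    ∉Z : ∀ {p} → W p ≡ false → Z p ≡ false
    ∉Z {p} h with true⊎false (Z p)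
    ... | inj₂ h' = h'
    ... | inj₁ h' = ⊥-elim (false≢true h (Z⊆W h'))
    v∉Z = ∉Z v∉W
    x∉Z = ∉Z (U-W x∈U)
    y∉Z = ∉Z (U-W y∈U)
    x≢y : x ≢ y
    x≢y refl = fxy x (trans (e-diag isProper x) (≡-sym hole))
    open Exchange v x (U≢v x∈U ∘ ≡-sym) Z v∉Z x∉Z e isProper
    okP : ∀ {w c} → Z w ≡ true → e x w ≡ just c →
          (∀ z → Z z ≡ false → e v z ≢ just c) × (U v ≡ false → c ≢ vcol v) × adj G v w ≡ true
    okP zw h with hx zw | hv zw
    ... | c , h' , p , q | d , h″ , _ with refl ← Maybe.just-injective (trans (≡-sym h) h') = q , (λ _ → p) , supp h″
    okQ : ∀ {w c} → Z w ≡ true → e v w ≡ just c →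
          (∀ z → Z z ≡ false → e x z ≢ just c) × (U x ≡ false → c ≢ vcol x) × adj G x w ≡ true
    okQ zw h with hx zw | hv zw
    ... | c , h' , p , q | d , h″ , r with refl ← Maybe.just-injective (trans (≡-sym h) h″) =
      r , (λ n → ⊥-elim (false≢true n x∈U)) , supp h'
    in-v : ∀ {z} → Z z ≡ true → exchange v z ≡ e x z
    in-v h = trans (exchange-col h v) (cong (λ s → e s _) σ-P)
    in-x : ∀ {z} → Z z ≡ true → exchange x z ≡ e v z
    in-x h = trans (exchange-col h x) (cong (λ s → e s _) σ-Q)
    row-y : ∀ z → exchange y z ≡ e y z
    row-y = exchange-other (U≢v y∈U) (x≢y ∘ ≡-sym) y∉Z
    in-Z-just : ∀ p {q} → Z q ≡ true → exchange p q ≡ nothing → e p q ≡ nothing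
    in-Z-just p zq h with view p
    ... | isP with _ , h' , _ ← hx zq with () ← trans (≡-sym h') (trans (≡-sym (in-v zq)) h)
    in-Z-just p zq h | isQ with _ , h' , _ ← hv zq with () ← trans (≡-sym h') (trans (≡-sym (in-x zq)) h)
    in-Z-just p zq h | other n n' = trans (≡-sym (trans (exchange-col zq p) (cong (λ s → e s _) (σ-other n n')))) h
    nothing₂ : ∀ p q → exchange p q ≡ nothing → e p q ≡ nothing
    nothing₂ p q h with true⊎false (Z q) | true⊎false (Z p)
    ... | inj₁ zq | _ = in-Z-just p zq h
    ... | inj₂ _ | inj₁ zp = trans (e-sym p q) (in-Z-just q zp (trans (exchange-sym q p) h))
    ... | inj₂ zq | inj₂ zp = trans (≡-sym (exchange-out zp zq)) h
    hole₂ : Hole x exchange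
    hole₂ = record { isProper = exchange-proper okP okQ ; x∈U = x∈U ; hole = trans (exchange-out v∉Z x∉Z) hole
                   ; only = λ {p} {q} a h → only a (nothing₂ p q h) }
    -- The colours arriving at `x` come from edges between `v` and `Z`; that of `vy` is not among
    -- them, as `y` lies outside `Z`.
    free₂ : Free exchange x y
    free₂ z h with true⊎false (Z z) | trans h (trans (exchange-out v∉Z y∉Z) evy)
    ... | inj₁ zz | h' = false≢true y∉Z (subst (λ s → Z s ≡ true) (proper (trans (≡-sym (in-x zz)) h') evy) zz)
    ... | inj₂ zz | h' = mxy z (trans (≡-sym (exchange-out x∉Z zz)) h')
    -- `v` loses `β` with the edge `vw` and does not get it back, since `β` is missing at `x`.
    miss-v : Miss exchange v β
    miss-v z h with true⊎false (Z z)
    ... | inj₁ zz = mx z (trans (≡-sym (in-v zz)) h)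
    ... | inj₂ zz = false≢true zz (subst (λ s → Z s ≡ true) (proper evw (trans (≡-sym (exchange-out v∉Z zz)) h)) Zw)
    miss-y : Miss exchange y β
    miss-y z h = fyw z (trans (≡-sym (row-y z)) (trans h (≡-sym evw)))

  -- Counting colours at the hole

  Has : EdgeColouring → V → Colour → Set
  Has e p c = ∃[ z ] e p z ≡ just c

  has? : ∀ e p c → Dec (Has e p c)
  has? e p c = Fin.any? (λ z → Maybe.≡-dec _≟_ (e p z) (just c))

  freeW freeU : EdgeColouring → V → V → Bool
  freeW e x w = W w ∧ ⌊ free? e x w ⌋
  freeU e x y = U y ∧ ⌊ free? e x y ⌋

  freeW⁻ : ∀ e x {w} → w ∈ elems (freeW e x) → W w ≡ true × Free e x w
  freeW⁻ e x {w} h with ∧-true {W w} (∈-elems⁻ {p = freeW e x} h)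
  ... | a , b = a , ⌊⌋-true (free? e x w) b

  freeU⁻ : ∀ e x {w} → w ∈ elems (freeU e x) → U w ≡ true × Free e x w
  freeU⁻ e x {w} h with ∧-true {U w} (∈-elems⁻ {p = freeU e x} h)
  ... | a , b = a , ⌊⌋-true (free? e x w) b

  -- What remains when neither `finish` nor `transfer-finish` applies: the first two fields say so
  -- for `b`, the others follow by counting colours.
  record Obstruction (e : EdgeColouring) (x : V) (b : Colour) : Set where
    field
      x-has      : Has e x b
      free-has   : ∀ {y} → U y ≡ true → Free e x y → Has e y b
      bad-unique : ∀ {w w'} → W w ≡ true → W w' ≡ true → ¬ Free e x w → ¬ Free e x w' → w ≡ w'
      one-free   : ∃[ y ] U y ≡ true × Free e x y
      two-free   : ∀ {w} → W w ≡ true → ¬ Free e x w →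
                   ∃[ y ] ∃[ y' ] y ≢ y' × (U y ≡ true × Free e x y) × (U y' ≡ true × Free e x y')

  b-nbr : ∀ {e b y w} → Proper e → Miss e v b → U y ≡ true → e y w ≡ just b → W w ≡ true
  b-nbr {e} {y = y} pr mv yU h with U-nbr yU (Proper.supp pr h)
  ... | inj₁ refl = ⊥-elim (mv y (trans (Proper.e-sym pr v y) h))
  ... | inj₂ r = r

  -- Not only `b` is tried for `vx`, but every colour. If all fail, each colour occurs at `x`,
  -- equals `vcol v`, or lies on an edge from `v` to a vertex free for `x`, which forces many free
  -- vertices.
  finish-or-obstruct : ∀ {x e b} → Hole x e → Miss e v b → b ≢ vcol v → Full ⊎ Obstruction e x b
  finish-or-obstruct {x} {e} {b} st mv bv
    with Fin.any? (λ c → ¬? (has? e v c) ×-dec ¬? (c ≟ vcol v) ×-dec ¬? (has? e x c))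
  ... | yes (c , mvc , cv , mxc) = inj₁ (finish st (λ q h → mvc (q , h)) cv (λ q h → mxc (q , h)))
  ... | no none with Fin.any? (λ y → U y Bool.≟ true ×-dec free? e x y ×-dec ¬? (has? e y b))
  ... | yes (y , yU , fy , my) = inj₁ (transfer-finish st yU fy mv bv (λ q h → my (q , h)))
  ... | no none' = inj₂ record
    { x-has = x-has
    ; free-has = free-has
    ; bad-unique = bad-unique
    ; one-free = one-free
    ; two-free = two-free
    }
    where
    open Hole st
    g ξ : ℕ
    g = length (elems (freeW e x))
    ξ = length (elems (freeU e x))

    x-has : Has e x b
    x-has with has? e x b
    ... | yes h = h
    ... | no h = ⊥-elim (none (b , (λ { (q , r) → mv q r }) , bv , h))

    free-has : ∀ {y} → U y ≡ true → Free e x y → Has e y b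
    free-has {y} yU fy with has? e y b
    ... | yes h = h
    ... | no h = ⊥-elim (none' (y , yU , fy , h))

    x≢free : ∀ {y} → Free e x y → x ≢ y
    x≢free f refl = f x (trans (e-diag isProper x) (≡-sym hole))

    L₁ L₂ L₃ : List (Maybe Colour)
    L₁ = map (e x) (elems (adj G x))
    L₂ = map (e v) (elems (freeW e x))
    L₃ = map (e v) (elems (freeU e x))

    covered : ∀ c → c ∈ L₁ ++ just (vcol v) ∷ L₂ ++ L₃
    covered nothing = ∈-++⁺ˡ (subst (_∈ L₁) (trans (e-sym x v) hole)
      (∈-map⁺ (e x) (∈-elems⁺ {p = adj G x} (trans (sym G _ _) (U-adj x∈U)))))
    covered (just c) with has? e x c
    ... | yes (z , h) = ∈-++⁺ˡ (subst (_∈ L₁) h (∈-map⁺ (e x) (∈-elems⁺ {p = adj G x} (supp h))))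
    ... | no mx with c ≟ vcol v
    ... | yes refl = ∈-++⁺ʳ L₁ (here refl)
    ... | no c≢ with has? e v c
    ... | no mvc = ⊥-elim (none (c , mvc , c≢ , mx))
    ... | yes (q , h) with nbr-of-v (supp h)
    ... | inj₁ qW = ∈-++⁺ʳ L₁ (there (∈-++⁺ˡ (subst (_∈ L₂) h (∈-map⁺ (e v) (∈-elems⁺ {p = freeW e x}
      (∧-intro qW (⌊⌋-intro (free? e x q) (Miss→Free e x h (λ z r → mx (z , r))))))))))
    ... | inj₂ qU = ∈-++⁺ʳ L₁ (there (∈-++⁺ʳ L₂ (subst (_∈ L₃) h (∈-map⁺ (e v) (∈-elems⁺ {p = freeU e x}
      (∧-intro qU (⌊⌋-intro (free? e x q) (Miss→Free e x h (λ z r → mx (z , r))))))))))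

    -- At most k + 1 + g + ξ entries cover D + 2 values: the D + 1 colours, and `nothing`, which
    -- accounts for the hole among the edges at `x`.
    k+k≤2+g+ξ : k + k ≤ 2 + (g + ξ)
    k+k≤2+g+ξ = +-cancelˡ-≤ k _ _ (begin
      k + (k + k)                    ≤⟨ 3k≤3+D ⟩
      1 + (2 + D)                    ≤⟨ s≤s (colours-covered _ covered) ⟩
      1 + length (L₁ ++ just (vcol v) ∷ L₂ ++ L₃) ≡⟨ cong suc (trans (length-++ L₁)
                                          (cong₂ (λ l r → l + suc r) (trans (length-map (e x) (elems (adj G x))) (length-elems (adj G x)))
                                            (trans (length-++ L₂) (cong₂ _+_ (length-map (e v) (elems (freeW e x)))
                                                                             (length-map (e v) (elems (freeU e x))))))) ⟩
      1 + (count (adj G x) + (1 + (g + ξ))) ≤⟨ s≤s (+-monoˡ-≤ _ (U-degree x∈U)) ⟩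
      1 + (k + (1 + (g + ξ)))        ≡⟨ ≡-sym (+-suc k _) ⟩
      k + (2 + (g + ξ))              ∎)
      where open ≤-Reasoning

    W-length : ∀ {xs} → Unique xs → (∀ {w} → w ∈ xs → W w ≡ true) → length xs ≤ k
    W-length u h = ≤-trans (length-≤-⊆ u (λ w∈ → ∈-elems⁺ {p = W} (h w∈))) (≤-trans (≤-reflexive (length-elems W)) W-size)

    -- `x` and the free vertices of `U` send their edges of colour `b` to different vertices of `W`.
    1+ξ≤k : 1 + ξ ≤ k
    1+ξ≤k = ≤-trans (length-≤-injection (λ y w → e y w ≡ just b)
        (λ {a} {a'} {w} h h' → proper (trans (e-sym w a) h) (trans (e-sym w a') h'))
        (All.tabulate (λ i∈ → x≢free (proj₂ (freeU⁻ e x i∈))) ∷ elems-unique (freeU e x)) nbr)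
      (≤-trans (≤-reflexive (length-elems W)) W-size)
      where
      nbr' : ∀ {y} → U y ≡ true → Has e y b → ∃[ w ] w ∈ elems W × e y w ≡ just b
      nbr' yU (w , h) = w , ∈-elems⁺ {p = W} (b-nbr isProper mv yU h) , h
      nbr : ∀ {y} → y ∈ x ∷ elems (freeU e x) → ∃[ w ] w ∈ elems W × e y w ≡ just b
      nbr (here refl) = nbr' x∈U x-has
      nbr (there y∈) with yU , f ← freeU⁻ e x y∈ = nbr' yU (free-has yU f)

    freeW-length : g ≤ k
    freeW-length = W-length (elems-unique (freeW e x)) (proj₁ ∘ freeW⁻ e x)

    bad∉ : ∀ {w} → ¬ Free e x w → All (w ≢_) (elems (freeW e x))
    bad∉ ¬f = All.tabulate (λ { i∈ refl → ¬f (proj₂ (freeW⁻ e x i∈)) })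

    bad-length : ∀ {w} → W w ≡ true → ¬ Free e x w → 1 + g ≤ k
    bad-length wW ¬f = W-length (bad∉ ¬f ∷ elems-unique (freeW e x))
      λ { (here refl) → wW ; (there h) → proj₁ (freeW⁻ e x h) }

    bad-unique : ∀ {w w'} → W w ≡ true → W w' ≡ true → ¬ Free e x w → ¬ Free e x w' → w ≡ w'
    bad-unique {w} {w'} wW wW' ¬f ¬f' with w ≟ w'
    ... | yes r = r
    -- Two bad vertices would give g ≤ k - 2; with ξ ≤ k - 1 the count falls short of 2k.
    ... | no w≢w' = ⊥-elim (<⇒≱ (begin-strict
      2 + (g + ξ)  ≤⟨ +-monoˡ-≤ ξ (W-length ((w≢w' ∷ bad∉ ¬f) ∷ (bad∉ ¬f' ∷ elems-unique (freeW e x)))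
                       λ { (here refl) → wW ; (there (here refl)) → wW' ; (there (there h)) → proj₁ (freeW⁻ e x h) }) ⟩
      k + ξ        <⟨ +-monoʳ-< k 1+ξ≤k ⟩
      k + k        ∎) k+k≤2+g+ξ)
      where open ≤-Reasoning

    one-free : ∃[ y ] U y ≡ true × Free e x y
    one-free = go (elems (freeU e x)) (λ h → freeU⁻ e x h) k+k≤2+g+ξ
      where
      go : ∀ ys → (∀ {y} → y ∈ ys → U y ≡ true × Free e x y) → k + k ≤ 2 + (g + length ys) → ∃[ y ] U y ≡ true × Free e x y
      go (y ∷ _) h _ = y , h (here refl)
      -- With ξ = 0 the count gives 2k ≤ 2 + g ≤ 2 + k, against k ≥ 3.
      go [] _ le = ⊥-elim (<⇒≱ (begin-strict
        2 + (g + 0)  ≡⟨ cong (2 +_) (+-identityʳ g) ⟩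
        2 + g        <⟨ +-mono-<-≤ 3≤k freeW-length ⟩
        k + k        ∎) le)
        where open ≤-Reasoning

    two-free : ∀ {w} → W w ≡ true → ¬ Free e x w →
      ∃[ y ] ∃[ y' ] y ≢ y' × (U y ≡ true × Free e x y) × (U y' ≡ true × Free e x y')
    two-free wW ¬f with two-elements (elems-unique (freeU e x)) 2≤ξ
      where
      open ≤-Reasoning
      -- A bad vertex gives g ≤ k - 1, hence ξ ≥ k - 1 ≥ 2.
      2≤ξ : 2 ≤ ξ
      2≤ξ = s≤s⁻¹ (≤-trans 3≤k (+-cancelˡ-≤ k _ _ (begin
        k + k              ≤⟨ k+k≤2+g+ξ ⟩
        1 + (1 + g + ξ)    ≤⟨ s≤s (+-monoˡ-≤ ξ (bad-length wW ¬f)) ⟩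
        1 + (k + ξ)        ≡⟨ ≡-sym (+-suc k ξ) ⟩
        k + (1 + ξ)        ∎)))
    ... | y , y' , y≢y' , h , h' = y , y' , y≢y' , freeU⁻ e x h , freeU⁻ e x h'

  -- Resolving an obstruction

  -- Moving the hole to `vy` changes the rows of `x` and `y` only by the colour of `vy`, which lies
  -- on no edge from `v` to `W`. So freedom of vertices of `W` persists, and `x` becomes free for
  -- `y`.
  module TransferFree {x e} (st : Hole x e) {y} (y∈U : U y ≡ true) (free : Free e x y) where
    open Hole st
    open Transfer st y∈U free public

    row-v-W : ∀ {w} → W w ≡ true → e₁ v w ≡ e v w
    row-v-W wW = row-v-other (U≢W x∈U wW ∘ ≡-sym) (U≢W y∈U wW ∘ ≡-sym)

    private
      y-at-v : e₁ y v ≡ nothing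
      y-at-v = trans (exchange-sym y v) row-v-y
      x-at-v : e₁ x v ≡ e v y
      x-at-v = trans (exchange-sym x v) row-v-x

    free-y⁺ : ∀ {w} → W w ≡ true → Free e y w → Free e₁ y w
    free-y⁺ wW f with free-colour-of isProper f
    ... | c , evw , m = Miss→Free e₁ y (trans (row-v-W wW) evw)
      (Miss₁ (U≢v y∈U) (λ z _ → m z) (λ h → case (trans (≡-sym y-at-v) h)))
      where
      case : nothing ≢ just c
      case ()

    free-x⁺ : ∀ {w} → W w ≡ true → Free e x w → Free e₁ x w
    free-x⁺ wW f with free-colour-of isProper f
    ... | c , evw , m = Miss→Free e₁ x (trans (row-v-W wW) evw)
      (Miss₁ (U≢v x∈U) (λ z _ → m z) (λ h → U≢W y∈U wW (proper (trans (≡-sym x-at-v) h) evw)))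

    free-y⁻ : ∀ {w} → W w ≡ true → Free e₁ y w → Free e y w
    free-y⁻ {w} wW f with free-colour-of proper₁ f
    ... | c , evw , m = Miss→Free e y (trans (≡-sym (row-v-W wW)) evw) λ z → go z (z ≟ v)
      where
      go : ∀ z → Dec (z ≡ v) → e y z ≢ just c
      go z (yes refl) h = U≢W y∈U wW (proper (trans (e-sym v y) h) (trans (≡-sym (row-v-W wW)) evw))
      go z (no n) h = m z (trans (row-other (U≢v y∈U) n) h)

    free-x-y : Free e₁ y x
    free-x-y with free-colour-of isProper free
    ... | c , evy , m = Miss→Free e₁ y (trans row-v-x evy)
      (Miss₁ (U≢v y∈U) (λ z n h → n (≡-sym (proper (trans (e-sym y v) evy) h))) (λ h → case (trans (≡-sym y-at-v) h)))
      where
      case : nothing ≢ just c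
      case ()

  -- Exchange over `w` alone: `v` gives the colour of `vw` to `xw` and receives `b`, which it was
  -- missing.
  swap₁ : ∀ {x e b w y} → Hole x e → Miss e v b → b ≢ vcol v → W w ≡ true → e x w ≡ just b →
    Free e x w → U y ≡ true → Free e x y → Free e y w → Full
  swap₁ {x} {e} {b} {w} {y} st mv bv wW exw fxw = exchange-finish st (only-at w)
      (λ h → subst (λ w → W w ≡ true) (≡-sym (at h)) wW)
      (λ h → b , trans (cong (e x) (at h)) exw , bv , λ z _ → mv z)
      (λ h → let (d , evw , m) = free-colour-of (Hole.isProper st) fxw in
             d , trans (cong (e v) (at h)) evw , λ z _ → m z)
      (⌊⌋-intro (w ≟ w) refl) fxw
    where
    at : ∀ {z} → only-at w z ≡ true → z ≡ w
    at {z} = ⌊⌋-true (z ≟ w)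

  -- Exchange over `w` and `w'`: at `v` the colour `α` moves from `vw` to `vw'` and `b` arrives on
  -- `vw`, so what `v` loses is the old colour of `vw'`.
  swap₂ : ∀ {x e b α w w' y} → Hole x e → Miss e v b → b ≢ vcol v → W w ≡ true → W w' ≡ true →
    e x w ≡ just b → e v w ≡ just α → e x w' ≡ just α →
    Free e x w' → U y ≡ true → Free e x y → Free e y w' → Full
  swap₂ {x} {e} {b} {α} {w} {w'} {y} st mv bv wW wW' exw evw exw' fxw' = exchange-finish st Z
      (λ {z} h → hW (at h)) (λ {z} h → hx (at h)) (λ {z} h → hv (at h)) (in-Z (inj₂ refl)) fxw'
    where
    open Hole st
    Z : V → Bool
    Z z = ⌊ (z ≟ w) ⊎-dec (z ≟ w') ⌋
    at : ∀ {z} → Z z ≡ true → z ≡ w ⊎ z ≡ w'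
    at {z} = ⌊⌋-true ((z ≟ w) ⊎-dec (z ≟ w'))
    in-Z : ∀ {z} → z ≡ w ⊎ z ≡ w' → Z z ≡ true
    in-Z {z} = ⌊⌋-intro ((z ≟ w) ⊎-dec (z ≟ w'))
    hW : ∀ {z} → z ≡ w ⊎ z ≡ w' → W z ≡ true
    hW (inj₁ refl) = wW
    hW (inj₂ refl) = wW'
    hx : ∀ {p} → p ≡ w ⊎ p ≡ w' → ∃[ c ] e x p ≡ just c × c ≢ vcol v × (∀ z → Z z ≡ false → e v z ≢ just c)
    hx (inj₁ refl) = b , exw , bv , λ z _ → mv z
    hx (inj₂ refl) = α , exw' , vert evw v∉U , λ z zf h → false≢true zf (in-Z (inj₁ (proper h evw)))
    hv : ∀ {p} → p ≡ w ⊎ p ≡ w' → ∃[ c ] e v p ≡ just c × (∀ z → Z z ≡ false → e x z ≢ just c)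
    hv (inj₁ refl) = α , evw , λ z zf h → false≢true zf (in-Z (inj₂ (proper h exw')))
    hv (inj₂ refl) with d , evw' , m ← free-colour-of isProper fxw' = d , evw' , λ z _ → m z

  module _ {x e b} (st : Hole x e) (mv : Miss e v b) (bv : b ≢ vcol v) where
    open Hole st

    b-edge-injective : ∀ {y y' w} → e y w ≡ just b → e y' w ≡ just b → y ≡ y'
    b-edge-injective h h' = proper (trans (e-sym _ _) h) (trans (e-sym _ _) h')

    x≢free : ∀ {y} → Free e x y → x ≢ y
    x≢free f refl = f x (trans (e-diag isProper x) (≡-sym hole))

    -- The situation after moving the hole to `vy` without success, expressed in the original
    -- colouring: `w` is the vertex w_y, and `bad-unique` comes from the obstruction for the moved
    -- hole.
    record Stuck (y : V) : Set where
      field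
        w          : V
        w∈W        : W w ≡ true
        ywb        : e y w ≡ just b
        bad-unique : ∀ {z z'} → W z ≡ true → W z' ≡ true → ¬ Free e y z → ¬ Free e y z' → z ≡ z'
        blocked    : Free e y w → ¬ Free e x w

    finish-or-stuck : ∀ {y} → U y ≡ true → Free e x y → Has e y b → Full ⊎ Stuck y
    finish-or-stuck {y} y∈U fxy (w , ywb)
      with finish-or-obstruct hole₁ (Miss-v mv) bv | free? e y w | free? e x w
      where open TransferFree st y∈U fxy
    ... | inj₁ full | _ | _ = inj₁ full
    -- The roles are exchanged here: the hole is at `vy`, and the swap finishes via `x`, which has
    -- become free for `y`.
    ... | inj₂ _ | yes fyw | yes fxw = inj₁ (swap₁ hole₁ (Miss-v mv) bv wW
            (trans (row-other (U≢v y∈U) (W≢v wW)) ywb) (free-y⁺ wW fyw) x∈U free-x-y (free-x⁺ wW fxw))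
      where
      open TransferFree st y∈U fxy
      wW = b-nbr isProper mv y∈U ywb
    ... | inj₂ o | no ¬f | _ = inj₂ record
      { w = w ; w∈W = b-nbr isProper mv y∈U ywb ; ywb = ywb
      ; bad-unique = λ zW zW' n n' → Obstruction.bad-unique o zW zW' (n ∘ free-y⁻ zW) (n' ∘ free-y⁻ zW')
      ; blocked = λ f → ⊥-elim (¬f f) }
      where open TransferFree st y∈U fxy
    ... | inj₂ o | yes _ | no ¬f = inj₂ record
      { w = w ; w∈W = b-nbr isProper mv y∈U ywb ; ywb = ywb
      ; bad-unique = λ zW zW' n n' → Obstruction.bad-unique o zW zW' (n ∘ free-y⁻ zW) (n' ∘ free-y⁻ zW')
      ; blocked = λ _ → ¬f }
      where open TransferFree st y∈U fxy

    module _ (o : Obstruction e x b) where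
      open Obstruction o

      w₀ : V
      w₀ = proj₁ x-has
      xw₀b : e x w₀ ≡ just b
      xw₀b = proj₂ x-has
      w₀∈W : W w₀ ≡ true
      w₀∈W = b-nbr isProper mv x∈U xw₀b

      FreeU : V → Set
      FreeU y = U y ≡ true × Free e x y

      w≢w₀ : ∀ {y w} → FreeU y → e y w ≡ just b → w ≢ w₀
      w≢w₀ (_ , f) h refl = x≢free f (b-edge-injective xw₀b h)

      -- If no swap applies, `w₀` is the one bad vertex for `y`. The other vertex `w` is then free
      -- for `y`, and being blocked it is bad for `x`.
      step-free : Free e x w₀ → ∀ {y} → FreeU y → Full ⊎ (∃[ w ] W w ≡ true × e y w ≡ just b × ¬ Free e x w)
      step-free f₀ {y} fy@(y∈U , fxy) with finish-or-stuck y∈U fxy (free-has y∈U fxy) | free? e y w₀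
      ... | inj₁ full | _ = inj₁ full
      ... | inj₂ _ | yes fyw₀ = inj₁ (swap₁ st mv bv w₀∈W xw₀b f₀ y∈U fxy fyw₀)
      ... | inj₂ s | no ¬fyw₀ with free? e y (Stuck.w s)
      ... | yes f = inj₂ (_ , Stuck.w∈W s , Stuck.ywb s , Stuck.blocked s f)
      ... | no ¬f = ⊥-elim (w≢w₀ fy (Stuck.ywb s) (Stuck.bad-unique s (Stuck.w∈W s) w₀∈W ¬f ¬fyw₀))

      -- A first free `y` yields a vertex bad for `x`, and hence two free vertices of `U`. Both
      -- would send their edge of colour `b` to the unique bad vertex, which is impossible.
      case-free : Free e x w₀ → Full
      case-free f₀ with one-free
      ... | y , fy with step-free f₀ fy
      ... | inj₁ full = full
      ... | inj₂ (_ , wW , _ , ¬f) with two-free wW ¬f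
      ... | y₁ , y₂ , y₁≢y₂ , f₁ , f₂ with step-free f₀ f₁ | step-free f₀ f₂
      ... | inj₁ full | _ = full
      ... | inj₂ _ | inj₁ full = full
      ... | inj₂ (w₁ , W₁ , b₁ , n₁) | inj₂ (w₂ , W₂ , b₂ , n₂) with refl ← bad-unique W₁ W₂ n₁ n₂ =
        ⊥-elim (y₁≢y₂ (b-edge-injective b₁ b₂))

      -- As `w₀` is the only vertex bad for `x`, the vertex `w` is free for `x`; being blocked it is
      -- the one bad vertex for `y`.
      step-bad : ¬ Free e x w₀ → ∀ {y} → FreeU y →
        Full ⊎ (∃[ w ] e y w ≡ just b × (∀ {z} → W z ≡ true → z ≢ w → Free e y z))
      step-bad ¬f₀ {y} fy@(y∈U , fxy) with finish-or-stuck y∈U fxy (free-has y∈U fxy)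
      ... | inj₁ full = inj₁ full
      ... | inj₂ s = inj₂ (_ , ywb , λ {z} zW z≢w → decidable-stable (free? e y z) (λ n → z≢w (bad-uniq zW w∈W n ¬fyw)))
        where
        open Stuck s renaming (bad-unique to bad-uniq)
        fxw : Free e x w
        fxw = decidable-stable (free? e x w) (λ n → w≢w₀ fy ywb (bad-unique w∈W w₀∈W n ¬f₀))
        ¬fyw : ¬ Free e y w
        ¬fyw f = blocked f fxw

      case-bad : ¬ Free e x w₀ → Full
      case-bad ¬f₀ with two-free w₀∈W ¬f₀
      ... | y₁ , y₂ , y₁≢y₂ , f₁ , f₂ with step-bad ¬f₀ f₁ | step-bad ¬f₀ f₂
      ... | inj₁ full | _ = full
      ... | inj₂ _ | inj₁ full = full
      ... | inj₂ (w₁ , b₁ , free₁) | inj₂ (w₂ , b₂ , free₂)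
        -- That `w₀` is free for `y₁` shows that `vw₀` is coloured. Its colour `α` occurs at `x`
        -- because `w₀` is not free for `x`.
        with free-colour-of isProper (free₁ w₀∈W (w≢w₀ f₁ b₁ ∘ ≡-sym))
      ... | α , evw₀ , _ with has? e x α
      ... | no ¬h = ⊥-elim (¬f₀ (Miss→Free e x evw₀ λ z h → ¬h (z , h)))
      ... | yes (w' , exw') = choose (w' ≟ w₁)
        where
        w'∈W : W w' ≡ true
        w'∈W with U-nbr x∈U (supp exw')
        ... | inj₂ r = r
        ... | inj₁ refl with () ← trans (≡-sym exw') (trans (e-sym x v) hole)
        w'≢w₀ : w' ≢ w₀
        w'≢w₀ refl = mv w₀ (trans evw₀ (trans (≡-sym exw') xw₀b))
        fxw' : Free e x w'
        fxw' with free? e x w'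
        ... | yes f = f
        ... | no n = ⊥-elim (w'≢w₀ (bad-unique w'∈W w₀∈W n ¬f₀))
        with-y : ∀ {y} → FreeU y → Free e y w' → Full
        with-y (y∈U , fxy) = swap₂ st mv bv w₀∈W w'∈W xw₀b evw₀ exw' fxw' y∈U fxy
        -- `w₁` and `w₂` differ because `y₁` and `y₂` do, so `w'` is free for at least one of `y₁`
        -- and `y₂`.
        choose : Dec (w' ≡ w₁) → Full
        choose (no n) = with-y f₁ (free₁ w'∈W n)
        choose (yes refl) = with-y f₂ (free₂ w'∈W λ { refl → y₁≢y₂ (b-edge-injective b₁ b₂) })

      resolve : Full
      resolve with free? e x w₀
      ... | yes f = case-free f
      ... | no ¬f = case-bad ¬f

  -- Filling the hole and colouring the vertices of `U`

  -- One of the at most D edges at `v` is the hole, so with `vcol v` at most D of the D + 1 colours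
  -- are excluded at `v`; `b` is another one.
  fill : ∀ {x e} → Hole x e → Full
  fill {x} {e} st with free-colour L (there (subst (_∈ map (e v) (elems (adj G v))) hole
      (∈-map⁺ (e v) (∈-elems⁺ {p = adj G v} (U-adj x∈U))))) L-length
    where
    open Hole st
    L : List (Maybe Colour)
    L = just (vcol v) ∷ map (e v) (elems (adj G v))
    L-length : length L ≤ suc D
    L-length = s≤s (≤-trans (≤-reflexive (trans (length-map (e v) (elems (adj G v))) (length-elems (adj G v)))) deg-v)
  ... | b , b∉ = finish' (finish-or-obstruct st mv (λ { refl → b∉ (here refl) }))
    where
    mv : Miss e v b
    mv q h = b∉ (there (subst (_∈ map (e v) (elems (adj G v))) h (∈-map⁺ (e v) (∈-elems⁺ {p = adj G v} (Hole.supp st h)))))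
    finish' : Full ⊎ Obstruction e x b → Full
    finish' (inj₁ full) = full
    finish' (inj₂ o) = resolve st mv (λ { refl → b∉ (here refl) }) o

  module _ (vcol-proper : ∀ {p q} → adj G p q ≡ true → U p ≡ false → U q ≡ false → vcol p ≢ vcol q) where

    -- `U` is independent, so its vertices can be coloured independently of each other; each avoids
    -- at most k edge colours and k neighbour colours.
    totalColouring : Full → TotalColouring G (suc D)
    totalColouring (e , pr , full) = record
      { vcol = vcol'
      ; ecol = ecol
      ; ecol-sym = λ p q a → Maybe.just-injective (trans (≡-sym (ecol-just a))
          (trans (e-sym p q) (ecol-just (trans (sym G q p) a))))
      ; vv = λ p q a → vv a (true⊎false (U p)) (true⊎false (U q))
      ; ee = λ p q r a a' q≢r h → q≢r (proper (ecol-just a) (trans (ecol-just a') (cong just (≡-sym h))))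
      ; ve = λ p q a → ve a (true⊎false (U p))
      }
      where
      open Proper pr
      ecol : V → V → Colour
      ecol p q with e p q
      ... | just c = c
      -- A dummy value, taken only on non-edges.
      ... | nothing = zero
      ecol-just : ∀ {p q} → adj G p q ≡ true → e p q ≡ just (ecol p q)
      ecol-just {p} {q} a with e p q in eq
      ... | just c = refl
      ... | nothing = ⊥-elim (full p q a eq)

      at : V → List (Maybe Colour)
      at u = map (e u) (elems (adj G u)) ++ map (just ∘ vcol) (elems (adj G u))
      at-length : ∀ {u} → U u ≡ true → length (nothing ∷ at u) ≤ suc D
      at-length {u} uU = s≤s (begin
        length (at u)    ≡⟨ trans (length-++ (map (e u) (elems (adj G u))))
                              (cong₂ _+_ (trans (length-map (e u) (elems (adj G u))) (length-elems (adj G u)))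
                                         (trans (length-map (just ∘ vcol) (elems (adj G u))) (length-elems (adj G u)))) ⟩
        count (adj G u) + count (adj G u)  ≤⟨ +-mono-≤ (U-degree uU) (U-degree uU) ⟩
        -- Since k ≥ 3, 3 + 2k ≤ 3k ≤ 3 + D.
        k + k            ≤⟨ +-cancelˡ-≤ 3 _ _ (≤-trans (+-monoˡ-≤ (k + k) 3≤k) 3k≤3+D) ⟩
        D                ∎)
        where open ≤-Reasoning
      fresh : ∀ u → ∃[ c ] (U u ≡ true → just c ∉ at u)
      fresh u with true⊎false (U u)
      ... | inj₁ uU = let (c , c∉) = free-colour (nothing ∷ at u) (here refl) (at-length uU) in c , λ _ c∈ → c∉ (there c∈)
      ... | inj₂ u∉U = zero , λ uU → ⊥-elim (false≢true u∉U uU)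

      vcol' : V → Colour
      vcol' u = if U u then proj₁ (fresh u) else vcol u
      vcol'-U : ∀ {u} → U u ≡ true → vcol' u ≡ proj₁ (fresh u)
      vcol'-U {u} h = cong (λ b → if b then proj₁ (fresh u) else vcol u) h
      vcol'-other : ∀ {u} → U u ≡ false → vcol' u ≡ vcol u
      vcol'-other {u} h = cong (λ b → if b then proj₁ (fresh u) else vcol u) h

      U-independent : ∀ {p q} → adj G p q ≡ true → U p ≡ true → U q ≡ true → ⊥
      U-independent a h h' with U-nbr h a
      ... | inj₁ r = U≢v h' r
      ... | inj₂ r = U≢W h' r refl

      vv-U : ∀ {p q} → adj G p q ≡ true → U p ≡ true → U q ≡ false → vcol' p ≢ vcol' q
      vv-U {p} {q} a h h' r = proj₂ (fresh p) h (∈-++⁺ʳ (map (e p) (elems (adj G p)))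
        (subst (λ c → just c ∈ map (just ∘ vcol) (elems (adj G p)))
          (trans (≡-sym (vcol'-other h')) (trans (≡-sym r) (vcol'-U h)))
          (∈-map⁺ (just ∘ vcol) (∈-elems⁺ {p = adj G p} a))))
      vv : ∀ {p q} → adj G p q ≡ true → U p ≡ true ⊎ U p ≡ false → U q ≡ true ⊎ U q ≡ false → vcol' p ≢ vcol' q
      vv a (inj₁ h) (inj₁ h') = ⊥-elim (U-independent a h h')
      vv a (inj₁ h) (inj₂ h') = vv-U a h h'
      vv a (inj₂ h) (inj₁ h') r = vv-U (trans (sym G _ _) a) h' h (≡-sym r)
      vv a (inj₂ h) (inj₂ h') r = vcol-proper a h h' (trans (≡-sym (vcol'-other h)) (trans r (vcol'-other h')))
      ve : ∀ {p q} → adj G p q ≡ true → U p ≡ true ⊎ U p ≡ false → ecol p q ≢ vcol' p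
      ve {p} {q} a (inj₁ h) r = proj₂ (fresh p) h (∈-++⁺ˡ (subst (_∈ map (e p) (elems (adj G p)))
        (trans (ecol-just a) (cong just (trans r (vcol'-U h)))) (∈-map⁺ (e p) (∈-elems⁺ {p = adj G p} a))))
      ve a (inj₂ h) r = vert (ecol-just a) h (trans r (vcol'-other h))

-- Removing an edge

-- Each edge occurs in both orientations; the length is the measure for the induction.
edgeList : (G : Graph) → List (Fin (n G) × Fin (n G))
edgeList G = filter (λ e → adj G (proj₁ e) (proj₂ e) Bool.≟ true) (cartesianProduct (allFin _) (allFin _))

module _ {G : Graph} where

  ∈-edgeList⁺ : ∀ {p q} → adj G p q ≡ true → (p , q) ∈ edgeList G
  ∈-edgeList⁺ {p} {q} a = ∈-filter⁺ (λ e → adj G (proj₁ e) (proj₂ e) Bool.≟ true)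
    (∈-cartesianProduct⁺ (∈-allFin p) (∈-allFin q)) a

  ∈-edgeList⁻ : ∀ {p q} → (p , q) ∈ edgeList G → adj G p q ≡ true
  ∈-edgeList⁻ h = proj₂ (∈-filter⁻ (λ e → adj G (proj₁ e) (proj₂ e) Bool.≟ true)
    {xs = cartesianProduct (allFin _) (allFin _)} h)

  edgeList-unique : Unique (edgeList G)
  edgeList-unique = Unique.filter⁺ (λ e → adj G (proj₁ e) (proj₂ e) Bool.≟ true)
    (Unique.cartesianProduct⁺ (allFin⁺ _) (allFin⁺ _))

module Delete (G : Graph) (v x : Fin (n G)) where

  delete : Graph
  delete = record
    { n = n G
    ; adj = λ p q → adj G p q ∧ not ⌊ sameEdge? v x p q ⌋
    ; sym = λ p q → cong₂ (λ a b → a ∧ not b) (sym G p q) (same-sym p q)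
    ; irrefl = λ p → cong (_∧ not ⌊ sameEdge? v x p p ⌋) (irrefl G p)
    }
    where
    same-sym : ∀ p q → ⌊ sameEdge? v x p q ⌋ ≡ ⌊ sameEdge? v x q p ⌋
    same-sym p q with sameEdge? v x p q | sameEdge? v x q p
    ... | yes _ | yes _ = refl
    ... | no _ | no _ = refl
    ... | yes m | no ¬m = ⊥-elim (¬m (SameEdge-sym m))
    ... | no ¬m | yes m = ⊥-elim (¬m (SameEdge-sym m))

  adj-delete⁻ : ∀ {p q} → adj delete p q ≡ true → adj G p q ≡ true
  adj-delete⁻ h = proj₁ (∧-true h)

  adj-delete⁺ : ∀ {p q} → adj G p q ≡ true → ¬ SameEdge v x p q → adj delete p q ≡ true
  adj-delete⁺ {p} {q} a ¬m = ∧-intro a (cong not (⌊⌋-false (sameEdge? v x p q) ¬m))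

  deleted : adj delete v x ≡ false
  deleted = trans (cong (λ b → adj G v x ∧ not b) (⌊⌋-intro (sameEdge? v x v x) (inj₁ (refl , refl)))) (Bool.∧-zeroʳ _)

  edgeList-delete : adj G v x ≡ true → length (edgeList delete) < length (edgeList G)
  edgeList-delete a = length-≤-⊆
    (All.tabulate (λ i∈ r → vx∉ (subst (_∈ edgeList delete) (≡-sym r) i∈)) ∷ edgeList-unique {G = delete}) λ
    { (here refl) → ∈-edgeList⁺ {G = G} a
    ; (there i∈) → ∈-edgeList⁺ {G = G} (adj-delete⁻ (∈-edgeList⁻ {G = delete} i∈)) }
    where
    vx∉ : (v , x) ∉ edgeList delete
    vx∉ i∈ = false≢true deleted (∈-edgeList⁻ {G = delete} i∈)

  eliminationOrder-delete : ∀ {k} → EliminationOrder G k → EliminationOrder delete k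
  eliminationOrder-delete o = record
    { key = key ; key-inj = key-inj ; top = top ; top-size = top-size ; top-self = top-self
    ; top-adj = λ a → top-adj (adj-delete⁻ a) ; top-meet = top-meet }
    where open EliminationOrder o

colour-edgeless : ∀ {G D} → (∀ {p q} → adj G p q ≢ true) → TotalColouring G (suc D)
colour-edgeless none = record
  { vcol = λ _ → zero
  ; ecol = λ _ _ → zero
  ; ecol-sym = λ _ _ _ → refl
  ; vv = λ _ _ a → ⊥-elim (none a)
  ; ee = λ _ _ _ a → ⊥-elim (none a)
  ; ve = λ _ _ a → ⊥-elim (none a)
  }

-- The induction on the number of edges

module _ {k D : ℕ} (3≤k : 3 ≤ k) (3k≤3+D : k + (k + k) ≤ 3 + D) where

  -- Larger keys come earlier, so `maximal` makes `v` the earliest vertex with an earlier neighbour.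
  module EarliestVertex (G : Graph) (degree≤D : ∀ v → degree G v ≤ D) (o : EliminationOrder G k)
    (v x : Fin (n G)) (vx : adj G v x ≡ true) (v<x : EliminationOrder.key o v < EliminationOrder.key o x)
    (maximal : ∀ p → (∃[ q ] adj G p q ≡ true × EliminationOrder.key o p < EliminationOrder.key o q) →
               EliminationOrder.key o p ≤ EliminationOrder.key o v)
    (c : TotalColouring (Delete.delete G v x) (suc D))
    where

    open EliminationOrder o
    open Delete G v x
    open TotalColouring c

    W : Fin (n G) → Bool
    W w = top v w ∧ ⌊ key w <? key v ⌋

    W⁻ : ∀ {w} → W w ≡ true → top v w ≡ true × key w < key v
    W⁻ {w} h = let (a , b) = ∧-true h in a , ⌊⌋-true (key w <? key v) b

    W⁺ : ∀ {w} → top v w ≡ true → key w < key v → W w ≡ true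
    W⁺ {w} a lt = ∧-intro a (⌊⌋-intro (key w <? key v) lt)

    ¬W : ∀ {w} → ¬ (key w < key v) → W w ≡ false
    ¬W h = Bool.¬-not (h ∘ proj₂ ∘ W⁻)

    v∉W : W v ≡ false
    v∉W = ¬W (<-irrefl refl)

    W-size : count W ≤ k
    W-size = s≤s⁻¹ (≤-trans (count-mono-< {p = W} {q = top v} (λ _ → proj₁ ∘ W⁻) v∉W (top-self v)) (top-size v))

    U : Fin (n G) → Bool
    U = outerNbr G v W

    key-≢ : ∀ {p q} → adj G p q ≡ true → key p ≢ key q
    key-≢ {p} a r with refl ← key-inj r = false≢true (irrefl G p) a

    U-adj : ∀ {u} → U u ≡ true → adj G u v ≡ true
    U-adj h = trans (sym G _ _) (proj₁ (∧-true h))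

    U-key : ∀ {u} → U u ≡ true → key v < key u
    U-key {u} h = ≰⇒> λ le → false≢true (cong not (W⁺ (top-adj (proj₁ (∧-true h)) le)
      (≤∧≢⇒< le (key-≢ (U-adj h))))) (proj₂ (∧-true {adj G v u} h))

    U-nbr-key : ∀ {u w} → U u ≡ true → adj G u w ≡ true → key w ≤ key u
    U-nbr-key h a = ≮⇒≥ λ lt → <⇒≱ (U-key h) (maximal _ (_ , a , lt))

    -- By the choice of `v`, no neighbour of `u` is earlier than `u`, so all of them lie in `top u`,
    -- together with `u` itself.
    U-degree : ∀ {u} → U u ≡ true → count (adj G u) ≤ k
    U-degree {u} h = s≤s⁻¹ (≤-trans (count-mono-< {p = adj G u} {q = top u} (λ _ a → top-adj a (U-nbr-key h a)) (irrefl G u) (top-self u)) (top-size u))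

    -- If `w` is later than `v`, both lie in `top u`, and `top-meet` puts `w` into `top v`. If it is
    -- earlier than `v`, its earlier neighbour `u` contradicts the choice of `v`.
    U-nbr : ∀ {u w} → U u ≡ true → adj G u w ≡ true → w ≡ v ⊎ W w ≡ true
    U-nbr {u} {w} h a with <-cmp (key w) (key v)
    ... | tri≈ _ r _ = inj₁ (key-inj r)
    ... | tri< lt _ _ = inj₂ (W⁺ (top-meet (top-adj (U-adj h) (<⇒≤ (U-key h))) (top-adj a (U-nbr-key h a)) (<⇒≤ lt)) lt)
    ... | tri> _ _ lt = ⊥-elim (<⇒≱ lt (maximal w (u , trans (sym G w u) a ,
            ≤∧≢⇒< (U-nbr-key h a) (key-≢ a ∘ ≡-sym))))

    x∈U : U x ≡ true
    x∈U = ∧-intro vx (cong not (¬W (<⇒≯ v<x)))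

    open Recolouring G k D 3≤k 3k≤3+D v (degree≤D v) W v∉W W-size U-degree U-nbr vcol using (Hole; fill; totalColouring)

    e₀ : Fin (n G) → Fin (n G) → Maybe (Fin (suc D))
    e₀ p q = if adj delete p q then just (ecol p q) else nothing

    e₀-just : ∀ {p q c} → e₀ p q ≡ just c → adj delete p q ≡ true × ecol p q ≡ c
    e₀-just {p} {q} h with adj delete p q
    e₀-just refl | true = refl , refl

    e₀-nothing : ∀ {p q} → e₀ p q ≡ nothing → adj delete p q ≡ false
    e₀-nothing {p} {q} h with adj delete p q
    ... | false = refl

    hole : Hole x e₀
    hole = record
      { isProper = record
        { e-sym = e₀-sym
        ; supp = λ h → adj-delete⁻ (proj₁ (e₀-just h))
        ; proper = λ {p} {q} {r} h h' → decidable-stable (q ≟ r) λ q≢r →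
            ee p q r (proj₁ (e₀-just h)) (proj₁ (e₀-just h')) q≢r
              (trans (proj₂ (e₀-just {p} {q} h)) (≡-sym (proj₂ (e₀-just {p} {r} h'))))
        ; vert = λ {p} {q} h _ r → ve p q (proj₁ (e₀-just h)) (trans (proj₂ (e₀-just {p} {q} h)) r)
        }
      ; x∈U = x∈U
      ; hole = cong (λ b → if b then just (ecol v x) else nothing) deleted
      ; only = λ {p} {q} a h → decidable-stable (sameEdge? v x p q) λ ¬m →
          false≢true (e₀-nothing {p} {q} h) (adj-delete⁺ a ¬m)
      }
      where
      e₀-sym : ∀ p q → e₀ p q ≡ e₀ q p
      e₀-sym p q with adj delete p q in a | adj delete q p in a'
      ... | true | true = cong just (ecol-sym p q a)
      ... | false | false = refl
      ... | true | false = ⊥-elim (false≢true (trans (sym delete p q) a') a)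
      ... | false | true = ⊥-elim (false≢true (trans (sym delete q p) a) a')

    colouring : TotalColouring G (suc D)
    -- The deleted edge has its end `x` in `U`, so outside `U` the given vertex colours are proper
    -- for `G` too.
    colouring = totalColouring (λ {p} {q} a p∉U q∉U → vv p q (adj-delete⁺ a λ
      { (inj₁ (_ , refl)) → false≢true q∉U x∈U
      ; (inj₂ (refl , _)) → false≢true p∉U x∈U })) (fill hole)

  -- `D` only bounds the degrees, as the maximum degree may drop when an edge is deleted.
  colour : ∀ G → EliminationOrder G k → (∀ v → degree G v ≤ D) → Acc _<_ (length (edgeList G)) → TotalColouring G (suc D)
  colour G o degree≤D (acc rec) = go (Fin.any? later?)
    where
    open EliminationOrder o
    later? : ∀ p → Dec (∃[ q ] adj G p q ≡ true × key p < key q)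
    later? p = Fin.any? (λ q → adj G p q Bool.≟ true ×-dec key p <? key q)
    go : Dec (∃[ p ] ∃[ q ] adj G p q ≡ true × key p < key q) → TotalColouring G (suc D)
    go (no none) = colour-edgeless λ {p} {q} a → edge a (<-cmp (key p) (key q))
      where
      edge : ∀ {p q} → adj G p q ≡ true → Tri (key p < key q) (key p ≡ key q) (key q < key p) → ⊥
      edge a (tri< lt _ _) = none (_ , _ , a , lt)
      edge {p} a (tri≈ _ r _) with refl ← key-inj r = false≢true (irrefl G p) a
      edge a (tri> _ _ lt) = none (_ , _ , trans (sym G _ _) a , lt)
    go (yes some) with exists-argmax later? key some
    ... | v , (x , vx , v<x) , maximal =
      EarliestVertex.colouring G degree≤D o v x vx v<x maximal (colour delete (eliminationOrder-delete o)
        (λ p → ≤-trans (count-mono {p = adj delete p} {q = adj G p} (λ _ → adj-delete⁻)) (degree≤D p)) (rec (edgeList-delete vx)))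
      where open Delete G v x

-- The lower bound and the theorem

-- The colour of `v` and those of its edges are pairwise different; in `R` a neighbour `w` stands
-- for the edge `vw`, and `v` for itself.
colours-at-vertex : ∀ {G m} → TotalColouring G m → ∀ v → suc (degree G v) ≤ m
colours-at-vertex {G} {m} c v = subst₂ _≤_ (cong suc (length-elems (adj G v))) (length-tabulate id)
  (length-≤-injection R R-inj (All.tabulate (λ { i∈ refl → false≢true (irrefl G v) (nbr i∈) }) ∷ elems-unique (adj G v))
    λ { (here refl) → _ , ∈-allFin _ , inj₁ (refl , refl) ; (there i∈) → _ , ∈-allFin _ , inj₂ (nbr i∈ , refl) })
  where
  open TotalColouring c
  nbr : ∀ {w} → w ∈ elems (adj G v) → adj G v w ≡ true
  nbr = ∈-elems⁻ {p = adj G v}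
  R : Fin (n G) → Fin m → Set
  R w c = (w ≡ v × c ≡ vcol v) ⊎ (adj G v w ≡ true × c ≡ ecol v w)
  R-inj : ∀ {w w' c} → R w c → R w' c → w ≡ w'
  R-inj (inj₁ (r , _)) (inj₁ (r' , _)) = trans r (≡-sym r')
  R-inj (inj₁ (_ , h)) (inj₂ (a , h')) = ⊥-elim (ve v _ a (trans (≡-sym h') h))
  R-inj (inj₂ (a , h)) (inj₁ (_ , h')) = ⊥-elim (ve v _ a (trans (≡-sym h) h'))
  R-inj {w} {w'} (inj₂ (a , h)) (inj₂ (a' , h')) with w ≟ w'
  ... | yes r = r
  ... | no w≢w' = ⊥-elim (ee v w w' a a' w≢w' (trans (≡-sym h) h'))

Δ<colours : ∀ {G m} → 0 < Δ G → TotalColouring G m → Δ G < m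
Δ<colours {G} 0<Δ c with maxFin-attained (degree G)
... | inj₁ Δ≡0 = ⊥-elim (<-irrefl (≡-sym Δ≡0) 0<Δ)
... | inj₂ (v , e) = subst (_< _) e (colours-at-vertex c v)

theorem2 : ∀ (k : ℕ) (G : Graph) → 3 ≤ k → Treewidth≡ G k →
    3 * k ∸ 3 ≤ Δ G → TotalChromatic≡ G (suc (Δ G))
theorem2 k G 3≤k ((D , refl) , _) 3k∸3≤Δ =
  colour 3≤k 3k≤3+Δ G (eliminationOrder D) (≤-maxFin (degree G)) (<-wellFounded _) ,
  λ m m≤Δ c → <⇒≱ (Δ<colours 0<Δ c) (s≤s⁻¹ m≤Δ)
  where
  3k≤3+Δ : k + (k + k) ≤ 3 + Δ G
  3k≤3+Δ = subst (λ s → k + (k + s) ≤ 3 + Δ G) (+-identityʳ k) (≤-trans (m≤n+m∸n (3 * k) 3) (+-monoʳ-≤ 3 3k∸3≤Δ))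
  -- From 9 ≤ 3k ≤ 3 + Δ; it excludes a maximum that is 0 for lack of vertices.
  0<Δ : 0 < Δ G
  0<Δ = ≤-trans (s≤s z≤n) (+-cancelˡ-≤ 3 _ _ (≤-trans (+-mono-≤ 3≤k (+-mono-≤ 3≤k 3≤k)) 3k≤3+Δ))
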